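{- Let $K\subsetneq 2^{[n]}$ be a proper simplicial complex such that $\mathrm{Vert}(K)=[n]$. Then $K$ is a threshold complex (equivalently, $\Gamma = 2^{[n]}\setminus K$ is a weighted majority game with all weights strictly positive) if and only if the canonical fan $Fan(K)$ of $K$ is polytopal.
   Context: Notation: $[n]=\{1,\dots,n\}$. A simplicial complex $K\subseteq 2^{[n]}$ is a family of subsets with $\emptyset\in K$ that is closed under taking subsets; it is proper if $K\neq 2^{[n]}$. The condition $\mathrm{Vert}(K)=[n]$ means $\{i\}\in K$ for every $i\in[n]$ (there are no ghost vertices). $K$ is a threshold complex if there are strictly positive real weights $w=(w_1,\dots,w_n)$ and a real number $q$ (the quota) such that $K=Tr_{w<q}:=\{A\subseteq[n] : w(A)<q\}$, where $w(A)=\sum_{i\in A}w_i$. Equivalently $\Gamma=2^{[n]}\setminus K=\{A : w(A)\geq q\}$ is a weighted majority game with strictly positive weights (its members are the winning coalitions). The Alexander dual of $K$ is $K^\circ=\{A\subseteq[n] : [n]\setminus A\notin K\}$. The canonical fan $Fan(K)=Fan(\Gamma)$ lives in $H_0=\{x\in\mathbb{R}^n : x_1+\dots+x_n=0\}$. Put $\delta_i=e_i-\frac1n(e_1+\dots+e_n)$ and $\bar\delta_i=-\delta_i$ for $i\in[n]$. The cones of $Fan(K)$ are exactly the cones generated by $\{\delta_i : i\in A_1\}\cup\{\bar\delta_j : j\in A_2\}$ over all pairs $(A_1,A_2)$ with $A_1\in K$, $A_2\in K^\circ$, $A_1\cap A_2=\emptyset$. It is known that this is a complete simplicial fan in $H_0$.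 A fan in $H_0$ is polytopal if it is the (outer) normal fan of a convex polytope in $H_0$ (with $H_0$ identified with its dual by the standard inner product). -}

module Defs where

open import Level using (Level; 0ℓ) renaming (suc to lsuc)
open import Algebra.Bundles using (CommutativeRing)
open import Data.Bool.Base using (if_then_else_)
open import Data.Fin.Base using (Fin)
open import Data.Fin.Properties using (_≟_)
open import Data.Fin.Subset using (Subset; _⊆_; _∩_; ∁; ⊥; ⁅_⁆)
open import Data.Nat.Base using (ℕ)
open import Data.Product.Base using (Σ; ∃; ∃-syntax; _×_)
open import Data.Vec.Base using (lookup)
open import Data.Vec.Functional using (Vector)
open import Function.Bundles using (_⇔_)
open import Relation.Binary.Core using (Rel)
open import Relation.Binary.Structures using (IsStrictTotalOrder)
open import Relation.Nullary.Decidable.Core using (does)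
open import Relation.Nullary.Negation.Core using (¬_)
open import Relation.Unary using (Pred; Decidable; Satisfiable; _≐_)
open import Relation.Binary.PropositionalEquality.Core using (_≡_)
import Algebra.Properties.Monoid.Mult as Mult
import Algebra.Properties.Monoid.Sum as Sum
import Data.Vec.Functional.Relation.Binary.Equality.Setoid as VecEq
import Relation.Binary.Construct.StrictToNonStrict as ToNonStrict

-- The real numbers, characterised (up to isomorphism) as a Dedekind-complete
-- ordered field, in the classical sense: the order is trichotomous.  The
-- inverse is a total function about which nothing is said at 0.
record RealField (r : Level) : Set (lsuc r) where
  infix 4 _<_
  infix 8 _⁻¹
  field
    commutativeRing : CommutativeRing r r
  open CommutativeRing commutativeRing public
  field
    _⁻¹                : Carrier → Carrier
    0≉1                : ¬ 0# ≈ 1#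
    ⁻¹-inverse         : ∀ {x} → ¬ x ≈ 0# → x * x ⁻¹ ≈ 1#
    _<_                : Rel Carrier r
    isStrictTotalOrder : IsStrictTotalOrder _≈_ _<_
    +-monoˡ-<          : ∀ {x y} z → x < y → x + z < y + z
    *-positive         : ∀ {x y} → 0# < x → 0# < y → 0# < x * y
  open ToNonStrict _≈_ _<_ public using (_≤_)

  UpperBound : Pred Carrier r → Pred Carrier r
  UpperBound S u = ∀ x → S x → x ≤ u

  field
    supremum : (S : Pred Carrier r) → Satisfiable S → ∃ (UpperBound S) →
               ∃[ s ] (UpperBound S s × (∀ u → UpperBound S u → s ≤ u))

-- Membership in a family of subsets of [n] is classically decidable; face? records this.
record SimplicialComplex (n : ℕ) : Set₁ where
  field
    face   : Pred (Subset n) 0ℓ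
    face?  : Decidable face
    ∅-face : face ⊥
    ⊆-face : ∀ {A B} → A ⊆ B → face B → face A

open SimplicialComplex public using (face)

Proper : ∀ {n} → SimplicialComplex n → Set
Proper K = ¬ (∀ A → face K A)

NoGhostVertices : ∀ {n} → SimplicialComplex n → Set
NoGhostVertices K = ∀ i → face K ⁅ i ⁆

winning : ∀ {n} → SimplicialComplex n → Pred (Subset n) 0ℓ
winning K A = ¬ face K A

dualFace : ∀ {n} → SimplicialComplex n → Pred (Subset n) 0ℓ
dualFace K A = ¬ face K (∁ A)

module Geometry {r : Level} (ℝ : RealField r) where
  open RealField ℝ
  open Mult +-monoid using () renaming (_×_ to _·_)
  open Sum +-monoid using (sum; sum-syntax)
  open VecEq setoid using (_≋_)

  infixl 6 _⊕_

  sumOver : ∀ {n} → Subset n → Vector Carrier n → Carrier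
  sumOver A f = sum (λ i → if lookup A i then f i else 0#)

  IsThreshold : ∀ {n} → SimplicialComplex n → Set r
  IsThreshold {n} K =
    Σ (Vector Carrier n) λ w → Σ Carrier λ q →
      (∀ i → 0# < w i) × (∀ A → face K A ⇔ sumOver A w < q)

  IsPositiveWeightedMajorityGame : ∀ {n} → Pred (Subset n) 0ℓ → Set r
  IsPositiveWeightedMajorityGame {n} Γ =
    Σ (Vector Carrier n) λ w → Σ Carrier λ q →
      (∀ i → 0# < w i) × (∀ A → Γ A ⇔ q ≤ sumOver A w)

  _⊕_ : ∀ {n} → Vector Carrier n → Vector Carrier n → Vector Carrier n
  (x ⊕ y) k = x k + y k

  ⟨_,_⟩ : ∀ {n} → Vector Carrier n → Vector Carrier n → Carrier
  ⟨ x , y ⟩ = sum (λ k → x k * y k)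

  H₀ : ∀ {n} → Pred (Vector Carrier n) r
  H₀ x = sum x ≈ 0#

  e : ∀ {n} → Fin n → Vector Carrier n
  e i k = if does (i ≟ k) then 1# else 0#

  δ : ∀ {n} → Fin n → Vector Carrier n
  δ {n} i k = e i k - (n · 1#) ⁻¹ * ∑[ j < n ] e j k

  δ̄ : ∀ {n} → Fin n → Vector Carrier n
  δ̄ i k = - δ i k

  -- Σ_{i ∈ A} c i • v i
  combination : ∀ {m n} → Subset m → Vector Carrier m →
                (Fin m → Vector Carrier n) → Vector Carrier n
  combination A c v k = sumOver A (λ i → c i * v i k)

  -- Cones and fans are extensional: subsets of ℝⁿ, and sets of such subsets
  -- that are compared up to _≐_ on their members.
  Cone : ℕ → Set (lsuc r)
  Cone n = Pred (Vector Carrier n) r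

  Fan : ℕ → Set (lsuc r)
  Fan n = Pred (Cone n) r

  cone : ∀ {n} → Subset n → Subset n → Cone n
  cone {n} A₁ A₂ x =
    Σ (Vector Carrier n) λ a → Σ (Vector Carrier n) λ b →
      (∀ i → 0# ≤ a i) × (∀ j → 0# ≤ b j) ×
      x ≋ combination A₁ a δ ⊕ combination A₂ b δ̄

  canonicalFan : ∀ {n} → SimplicialComplex n → Fan n
  canonicalFan K C =
    ∃[ A₁ ] ∃[ A₂ ] (face K A₁ × dualFace K A₂ × A₁ ∩ A₂ ≡ ⊥ × C ≐ cone A₁ A₂)

  record Polytope (n : ℕ) : Set r where
    field
      size   : ℕ
      point  : Fin size → Vector Carrier n
      inH₀   : ∀ i → H₀ (point i)

  hull : ∀ {n} → Polytope n → Pred (Vector Carrier n) r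
  hull P x =
    Σ (Vector Carrier size) λ c →
      (∀ i → 0# ≤ c i) × sum c ≈ 1# × (∀ k → x k ≈ sum (λ i → c i * point i k))
    where open Polytope P

  maximisers : ∀ {n} → Polytope n → Vector Carrier n → Pred (Vector Carrier n) r
  maximisers P u x = hull P x × (∀ z → hull P z → ⟨ u , z ⟩ ≤ ⟨ u , x ⟩)

  normalCone : ∀ {n} → Polytope n → Pred (Vector Carrier n) r → Cone n
  normalCone P F y = H₀ y × (∀ x → F x → maximisers P y x)

  -- The nonempty faces of P are the nonempty sets of maximisers over P of
  -- linear functionals on H₀, i.e. of ⟨ u , _ ⟩ with u in H₀.
  normalFan : ∀ {n} → Polytope n → Fan n
  normalFan P C =
    ∃[ u ] (H₀ u × Satisfiable (maximisers P u) ×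
            C ≐ normalCone P (maximisers P u))

  IsPolytopal : ∀ {n} → Fan n → Set (lsuc r)
  IsPolytopal {n} 𝓕 = Σ (Polytope n) λ P → 𝓕 ≐ normalFan P

{-# OPTIONS --safe #-}
module Submission where

-- The cone of (A₁ , A₂) consists of the x in H₀ for which some level c satisfies x ≥ c off A₂ and
-- x ≤ c off A₁; so x lies in the relative interior of the
-- cone with A₁ = {x > c} and A₂ = {x < c}, for the c at which {x > c} is a face and {x ≥ c} is not.
--
-- Given weights w, choose a quota q that no coalition meets exactly and slice the box ∏ [lo , lo + w k]
-- by the hyperplane H₀, with n lo = - q.  Its vertices are indexed by the pivots, i.e. the pairs (A , i)
-- with A a face and A ∪ ⁅ i ⁆ not: coordinates in A are at the top, those outside A ∪ ⁅ i ⁆ at the bottom.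
-- A point of the slice maximises x exactly when it is at the top on {x > c} and at the bottom on {x < c}.
--
-- Conversely, let lo k and hi k be the extreme values of the k-th coordinate on a polytope with the
-- given normal fan.  The vertex v of a pivot (A , i) has v = hi on A and v = lo off A ∪ ⁅ i ⁆, and its
-- coordinates sum to 0, so w = hi - lo and q = - Σ lo satisfy v i - lo i = q - w(A); now lo i ≤ v i ≤ hi i
-- reads w(A) ≤ q ≤ w(A ∪ ⁅ i ⁆).

open import Defs
open import Level using (Level)
open import Data.Bool.Base using (true; false; if_then_else_)
open import Data.Fin.Base using (Fin; zero; suc; fromℕ<)
open import Data.Fin.Properties using (_≟_; any?)
open import Data.Fin.Subset using (Subset; inside; outside; _∈_; _∉_; _⊆_; _∪_; ∁; ⊤; ⁅_⁆) renaming (_-_ to _∖_)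
open import Data.Fin.Subset.Induction using (⊂-wellFounded; Acc; acc)
open import Data.Fin.Subset.Properties
open import Data.Nat.Base using (ℕ; zero; suc; NonZero; >-nonZero⁻¹)
open import Data.Product.Base using (∃; ∃-syntax; ∃₂; _×_; _,_; proj₁; proj₂)
open import Data.Sum.Base using (_⊎_; inj₁; inj₂; [_,_]′)
open import Data.Vec.Base using ([]; _∷_; there; lookup; tabulate)
open import Data.Vec.Functional using (Vector)
open import Data.Vec.Properties using ([]=⇒lookup; lookup⇒[]=; lookup∘tabulate)
open import Function.Base using (_∘_)
open import Function.Bundles using (_⇔_; mk⇔; Equivalence)
open import Relation.Binary.Bundles using (StrictTotalOrder)
open import Relation.Binary.Definitions using (tri<; tri≈; tri>)
open import Relation.Binary.PropositionalEquality.Core as ≡ using (_≡_; _≢_)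
open import Relation.Nullary.Decidable using (Dec; yes; no; does; _×-dec_; ¬?; dec-true; dec-false; decidable-stable)
open import Relation.Nullary.Negation using (¬_; contradiction)
open import Relation.Unary using (Pred; Decidable; Satisfiable; U; _≐_)
open import Relation.Unary.Properties using (U?; ≐-sym; ≐-trans)
import Algebra.Construct.NaturalChoice.Max as Max
import Algebra.Properties.Ring as RingProperties
import Algebra.Properties.Semiring.Mult as SemiringMult
import Algebra.Properties.Semiring.Sum as SemiringSum
import Data.List.Base as List
import Data.List.Extrema as Extrema
import Data.List.Membership.Propositional as List
import Data.List.Membership.Propositional.Properties as List
import Data.List.Relation.Unary.All as All
import Data.List.Relation.Unary.All.Properties as All
import Data.List.Relation.Unary.Any as Any
import Data.List.Relation.Unary.Any.Properties as Any
import Relation.Binary.Properties.StrictTotalOrder as StrictTotalOrderProperties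
import Relation.Binary.Reasoning.StrictPartialOrder as ≤-Reasoning

-- Membership in finite subsets.

private
  variable
    n : ℕ
    i : Fin n
    A B : Subset n

i∉p∪⁅j⁆ : ∀ {j : Fin n} → i ∉ A → i ≢ j → i ∉ A ∪ ⁅ j ⁆
i∉p∪⁅j⁆ i∉A i≢j = [ i∉A , i≢j ∘ x∈⁅y⁆⇒x≡y _ ]′ ∘ x∈p∪q⁻ _ _

p∪⁅x⁆⊆q : A ⊆ B → i ∈ B → A ∪ ⁅ i ⁆ ⊆ B
p∪⁅x⁆⊆q A⊆B i∈B = [ A⊆B , (λ x∈ → ≡.subst (_∈ _) (≡.sym (x∈⁅y⁆⇒x≡y _ x∈)) i∈B) ]′ ∘ x∈p∪q⁻ _ _

x∈p∪⁅x⁆ : ∀ (A : Subset n) i → i ∈ A ∪ ⁅ i ⁆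
x∈p∪⁅x⁆ A i = x∈p∪q⁺ (inj₂ (x∈⁅x⁆ i))

i∉p∖i : ∀ (A : Subset n) i → i ∉ A ∖ i
i∉p∖i (_ ∷ A) zero    ()
i∉p∖i (_ ∷ A) (suc i) (there i∈) = i∉p∖i A i i∈

p⊆p∖i∪⁅i⁆ : ∀ (A : Subset n) i → A ⊆ (A ∖ i) ∪ ⁅ i ⁆
p⊆p∖i∪⁅i⁆ A i {k} k∈A with k ≟ i
... | yes ≡.refl = x∈p∪⁅x⁆ (A ∖ i) i
... | no  k≢i    = x∈p∪q⁺ (inj₁ (x∈p∧x≢y⇒x∈p-y k∈A k≢i))

module _ {p} {P : Pred (Fin n) p} (P? : Decidable P) where

  comprehension : Subset n
  comprehension = tabulate (does ∘ P?)

  ∈-comprehension⁺ : P i → i ∈ comprehension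
  ∈-comprehension⁺ {i} Pi =
    lookup⇒[]= i _ (≡.trans (lookup∘tabulate (does ∘ P?) i) (dec-true (P? i) Pi))

  ∈-comprehension⁻ : i ∈ comprehension → P i
  ∈-comprehension⁻ {i} i∈ with P? i in eq
  ... | yes Pi = Pi
  ... | no  _  with () ← ≡.trans (≡.sym ([]=⇒lookup i∈))
                           (≡.trans (lookup∘tabulate (does ∘ P?) i) (≡.cong does eq))

module _ {a} {X : Set a} {x y : X} where

  if-∈ : i ∈ A → (if lookup A i then x else y) ≡ x
  if-∈ i∈A rewrite []=⇒lookup i∈A = ≡.refl

  if-∉ : i ∉ A → (if lookup A i then x else y) ≡ y
  if-∉ {i = i} {A} i∉A with lookup A i in eq
  ... | true  = contradiction (lookup⇒[]= i A eq) i∉A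
  ... | false = ≡.refl

-- Pivots of a simplicial complex.

module _ (K : SimplicialComplex n) where
  open SimplicialComplex K using (face?; ⊆-face)

  Pivotal : Subset n → Fin n → Set
  Pivotal A i = face K A × ¬ face K (A ∪ ⁅ i ⁆)

  pivotal? : ∀ A i → Dec (Pivotal A i)
  pivotal? A i = face? A ×-dec ¬? (face? (A ∪ ⁅ i ⁆))

  pivotal⇒∉ : Pivotal A i → i ∉ A
  pivotal⇒∉ (A∈K , A∪i∉K) i∈A = A∪i∉K (⊆-face (p∪⁅x⁆⊆q ⊆-refl i∈A) A∈K)

  -- Elements of `T` outside `A` are removed one at a time. The chain descends from a nonface to the
  -- face `A`, so some removal first yields a face, and the element removed there is the pivot. This
  -- is the source of all vertices used below.
  pivotal-between : ∀ {A T} → face K A → ¬ face K T → A ⊆ T →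
                    ∃₂ λ B i → A ⊆ B × B ∪ ⁅ i ⁆ ⊆ T × Pivotal B i
  pivotal-between {A} A∈K = go _ (⊂-wellFounded _)
    where
    remove : ∀ {T i} → i ∉ A → A ⊆ T → A ⊆ T ∖ i
    remove i∉A A⊆T k∈A = x∈p∧x≢y⇒x∈p-y (A⊆T k∈A) λ { ≡.refl → i∉A k∈A }

    go : ∀ T → Acc _ T → ¬ face K T → A ⊆ T →
         ∃₂ λ B i → A ⊆ B × B ∪ ⁅ i ⁆ ⊆ T × Pivotal B i
    go T (acc rec) T∉K A⊆T with any? (λ i → (i ∈? T) ×-dec ¬? (i ∈? A))
    ... | no  T⊆A = contradiction (⊆-face T⊆A′ A∈K) T∉K
      where
      T⊆A′ : T ⊆ A
      T⊆A′ {k} k∈T = decidable-stable (k ∈? A) λ k∉A → T⊆A (k , k∈T , k∉A)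
    ... | yes (i , i∈T , i∉A) with face? (T ∖ i)
    ...   | yes T∖i∈K = T ∖ i , i , remove i∉A A⊆T , p∪⁅x⁆⊆q (p─q⊆p T ⁅ i ⁆) i∈T ,
                        T∖i∈K , T∉K ∘ ⊆-face (p⊆p∖i∪⁅i⁆ T i)
    ...   | no  T∖i∉K with go (T ∖ i) (rec (x∈p⇒p-x⊂p i∈T)) T∖i∉K (remove i∉A A⊆T)
    ...     | B , j , A⊆B , B∪j⊆T∖i , pivotal =
              B , j , A⊆B , ⊆-trans B∪j⊆T∖i (p─q⊆p T ⁅ i ⁆) , pivotal

-- Order and arithmetic of the reals, with finite maxima and minima.

module OrderedField {r} (ℝ : RealField r) where
  open RealField ℝ hiding (zero)

  open RingProperties ring public
  open SemiringMult semiring using () renaming (_×_ to _·_)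

  strictTotalOrder : StrictTotalOrder r r r
  strictTotalOrder = record { isStrictTotalOrder = isStrictTotalOrder }

  open StrictTotalOrder strictTotalOrder public
    using (compare; _<?_; strictPartialOrder; <-respˡ-≈; <-respʳ-≈)
    renaming (irrefl to <-irrefl; asym to <-asym)
  open StrictTotalOrderProperties strictTotalOrder public
    using (_≤?_; totalOrder; ≤-respˡ-≈; ≤-respʳ-≈)
    renaming (refl to ≤-refl; reflexive to ≤-reflexive; trans to ≤-trans; antisym to ≤-antisym)
  open ≤-Reasoning strictPartialOrder

  ≮⇒≥ : ∀ {x y} → ¬ x < y → y ≤ x
  ≮⇒≥ {x} {y} x≮y with compare x y
  ... | tri< x<y _ _ = contradiction x<y x≮y
  ... | tri≈ _ x≈y _ = inj₂ (sym x≈y)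
  ... | tri> _ _ y<x = inj₁ y<x

  ≤⇒≯ : ∀ {x y} → x ≤ y → ¬ y < x
  ≤⇒≯ (inj₁ x<y) y<x = <-asym x<y y<x
  ≤⇒≯ (inj₂ x≈y) y<x = <-irrefl (sym x≈y) y<x

  ≰⇒> : ∀ {x y} → ¬ x ≤ y → y < x
  ≰⇒> {x} {y} x≰y with compare x y
  ... | tri< x<y _ _ = contradiction (inj₁ x<y) x≰y
  ... | tri≈ _ x≈y _ = contradiction (inj₂ x≈y) x≰y
  ... | tri> _ _ y<x = y<x

  <-≤-trans : ∀ {x y z} → x < y → y ≤ z → x < z
  <-≤-trans {x} {y} {z} x<y y≤z = begin-strict x <⟨ x<y ⟩ y ≤⟨ y≤z ⟩ z ∎

  ≤-<-trans : ∀ {x y z} → x ≤ y → y < z → x < z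
  ≤-<-trans {x} {y} {z} x≤y y<z = begin-strict x ≤⟨ x≤y ⟩ y <⟨ y<z ⟩ z ∎

  +-monoʳ-< : ∀ z {x y} → x < y → z + x < z + y
  +-monoʳ-< z x<y = <-respˡ-≈ (+-comm _ _) (<-respʳ-≈ (+-comm _ _) (+-monoˡ-< z x<y))

  +-monoˡ-≤ : ∀ z {x y} → x ≤ y → x + z ≤ y + z
  +-monoˡ-≤ z (inj₁ x<y) = inj₁ (+-monoˡ-< z x<y)
  +-monoˡ-≤ z (inj₂ x≈y) = inj₂ (+-congʳ x≈y)

  +-monoʳ-≤ : ∀ z {x y} → x ≤ y → z + x ≤ z + y
  +-monoʳ-≤ z (inj₁ x<y) = inj₁ (+-monoʳ-< z x<y)
  +-monoʳ-≤ z (inj₂ x≈y) = inj₂ (+-congˡ x≈y)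

  +-mono-≤ : ∀ {x y u v} → x ≤ y → u ≤ v → x + u ≤ y + v
  +-mono-≤ x≤y u≤v = ≤-trans (+-monoˡ-≤ _ x≤y) (+-monoʳ-≤ _ u≤v)

  +-mono-<-≤ : ∀ {x y u v} → x < y → u ≤ v → x + u < y + v
  +-mono-<-≤ x<y u≤v = <-≤-trans (+-monoˡ-< _ x<y) (+-monoʳ-≤ _ u≤v)

  +-mono-≤-< : ∀ {x y u v} → x ≤ y → u < v → x + u < y + v
  +-mono-≤-< x≤y u<v = ≤-<-trans (+-monoˡ-≤ _ x≤y) (+-monoʳ-< _ u<v)

  [x-y]+y≈x : ∀ x y → (x - y) + y ≈ x
  [x-y]+y≈x x y = //-rightDividesˡ y x

  x<y⇒0<y-x : ∀ {x y} → x < y → 0# < y - x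
  x<y⇒0<y-x {x} x<y = <-respˡ-≈ (-‿inverseʳ x) (+-monoˡ-< (- x) x<y)

  0<y-x⇒x<y : ∀ {x y} → 0# < y - x → x < y
  0<y-x⇒x<y {x} {y} 0<y-x = <-respˡ-≈ (+-identityˡ x) (<-respʳ-≈ ([x-y]+y≈x y x) (+-monoˡ-< x 0<y-x))

  y<x⇒y-x<0 : ∀ {x y} → y < x → y - x < 0#
  y<x⇒y-x<0 {x} y<x = <-respʳ-≈ (-‿inverseʳ x) (+-monoˡ-< (- x) y<x)

  y-x<0⇒y<x : ∀ {x y} → y - x < 0# → y < x
  y-x<0⇒y<x {x} {y} y-x<0 = <-respʳ-≈ (+-identityˡ x) (<-respˡ-≈ ([x-y]+y≈x y x) (+-monoˡ-< x y-x<0))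

  -‿anti-mono-< : ∀ {x y} → x < y → - y < - x
  -‿anti-mono-< {x} {y} x<y = 0<y-x⇒x<y (<-respʳ-≈ eq (x<y⇒0<y-x x<y))
    where
    eq : y - x ≈ - x - - y
    eq = begin-equality
      y - x      ≈⟨ +-comm y (- x) ⟩
      - x + y    ≈⟨ +-congˡ (-‿involutive y) ⟨
      - x - - y  ∎

  -‿anti-mono-≤ : ∀ {x y} → x ≤ y → - y ≤ - x
  -‿anti-mono-≤ (inj₁ x<y) = inj₁ (-‿anti-mono-< x<y)
  -‿anti-mono-≤ (inj₂ x≈y) = inj₂ (-‿cong (sym x≈y))

  -‿cancel-≤ : ∀ {x y} → - x ≤ - y → y ≤ x
  -‿cancel-≤ -x≤-y = ≤-respˡ-≈ (-‿involutive _) (≤-respʳ-≈ (-‿involutive _) (-‿anti-mono-≤ -x≤-y))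

  0<1 : 0# < 1#
  0<1 with compare 0# 1#
  ... | tri< 0<1 _ _ = 0<1
  ... | tri≈ _ 0≈1 _ = contradiction 0≈1 0≉1
  ... | tri> _ _ 1<0 = <-respʳ-≈ (trans (-1*x≈-x (- 1#)) (-‿involutive 1#)) (*-positive 0<-1 0<-1)
    where
    0<-1 : 0# < - 1#
    0<-1 = <-respˡ-≈ -0#≈0# (-‿anti-mono-< 1<0)

  -1<0 : - 1# < 0#
  -1<0 = <-respʳ-≈ -0#≈0# (-‿anti-mono-< 0<1)

  x-1<x : ∀ x → x - 1# < x
  x-1<x x = <-respʳ-≈ (+-identityʳ x) (+-monoʳ-< x -1<0)

  *-monoˡ-<-pos : ∀ {a x y} → 0# < a → x < y → a * x < a * y
  *-monoˡ-<-pos {a} {x} {y} 0<a x<y =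
    0<y-x⇒x<y (<-respʳ-≈ (x[y-z]≈xy-xz a y x) (*-positive 0<a (x<y⇒0<y-x x<y)))

  *-monoˡ-<-neg : ∀ {a x y} → a < 0# → x < y → a * y < a * x
  *-monoˡ-<-neg {a} {x} {y} a<0 x<y =
    <-respˡ-≈ (neg y) (<-respʳ-≈ (neg x) (-‿anti-mono-< (*-monoˡ-<-pos 0<-a x<y)))
    where
    0<-a : 0# < - a
    0<-a = <-respˡ-≈ -0#≈0# (-‿anti-mono-< a<0)
    neg : ∀ z → - (- a * z) ≈ a * z
    neg z = trans (-‿cong (sym (-‿distribˡ-* a z))) (-‿involutive (a * z))

  *-monoˡ-≤-nonNeg : ∀ {a x y} → 0# ≤ a → x ≤ y → a * x ≤ a * y
  *-monoˡ-≤-nonNeg (inj₁ 0<a) (inj₁ x<y) = inj₁ (*-monoˡ-<-pos 0<a x<y)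
  *-monoˡ-≤-nonNeg (inj₁ 0<a) (inj₂ x≈y) = inj₂ (*-congˡ x≈y)
  *-monoˡ-≤-nonNeg {a} {x} {y} (inj₂ 0≈a) _ = inj₂ (begin-equality
    a * x   ≈⟨ *-congʳ 0≈a ⟨
    0# * x  ≈⟨ zeroˡ x ⟩
    0#      ≈⟨ zeroˡ y ⟨
    0# * y  ≈⟨ *-congʳ 0≈a ⟩
    a * y   ∎)

  0<n·1 : ∀ n .{{_ : NonZero n}} → 0# < n · 1#
  0<n·1 (suc zero)      = <-respʳ-≈ (sym (+-identityʳ 1#)) 0<1
  0<n·1 n@(suc (suc m)) = <-respˡ-≈ (+-identityˡ 0#) (+-mono-<-≤ 0<1 (inj₁ (0<n·1 (suc m))))

  open Max totalOrder public using (_⊔_; x≤x⊔y; x≤y⊔x; ⊔-sel; x≤y⇒x⊔y≈y)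
    renaming (x≤y⇒y⊔x≈y to x≥y⇒x⊔y≈x)

  ⊔-lub-< : ∀ {x y z} → x < z → y < z → x ⊔ y < z
  ⊔-lub-< {x} {y} x<z y<z =
    [ (λ eq → <-respˡ-≈ (sym eq) x<z) , (λ eq → <-respˡ-≈ (sym eq) y<z) ]′ (⊔-sel x y)

  ⁻¹-positive : ∀ {x} → 0# < x → 0# < x ⁻¹
  ⁻¹-positive {x} 0<x = ≰⇒> λ x⁻¹≤0 → ≤⇒≯ (begin
    1#        ≈⟨ ⁻¹-inverse (λ x≈0 → <-irrefl (sym x≈0) 0<x) ⟨
    x * x ⁻¹  ≤⟨ *-monoˡ-≤-nonNeg (inj₁ 0<x) x⁻¹≤0 ⟩
    x * 0#    ≈⟨ zeroʳ x ⟩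
    0#        ∎) 0<1

  <-dense : ∀ {x y} → x < y → ∃[ z ] (x < z × z < y)
  <-dense {x} {y} x<y = ½ * (x + y) , x<m , m<y
    where
    2# = 1# + 1#
    0<2 : 0# < 2#
    0<2 = <-respˡ-≈ (+-identityˡ 0#) (+-mono-<-≤ 0<1 (inj₁ 0<1))
    ½ = 2# ⁻¹
    halve : ∀ z → ½ * (z + z) ≈ z
    halve z = begin-equality
      ½ * (z + z)            ≈⟨ *-congˡ (+-cong (*-identityˡ z) (*-identityˡ z)) ⟨
      ½ * (1# * z + 1# * z)  ≈⟨ *-congˡ (distribʳ z 1# 1#) ⟨
      ½ * (2# * z)           ≈⟨ *-assoc ½ 2# z ⟨
      ½ * 2# * z             ≈⟨ *-congʳ (*-comm ½ 2#) ⟩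
      2# * ½ * z             ≈⟨ *-congʳ (⁻¹-inverse (λ 2≈0 → <-irrefl (sym 2≈0) 0<2)) ⟩
      1# * z                 ≈⟨ *-identityˡ z ⟩
      z                      ∎
    x<m : x < ½ * (x + y)
    x<m = <-respˡ-≈ (halve x) (*-monoˡ-<-pos (⁻¹-positive 0<2) (+-monoʳ-< x x<y))
    m<y : ½ * (x + y) < y
    m<y = <-respʳ-≈ (halve y) (*-monoˡ-<-pos (⁻¹-positive 0<2) (+-monoˡ-< y x<y))

  module _ {p} {P : Pred (Fin n) p} (P? : Decidable P) (f : Fin n → Carrier) where

    candidates : List.List (Fin n)
    candidates = List.filter P? (List.allFin n)

    argmax-exists : ∃ P → ∃[ i ] (P i × ∀ j → P j → f j ≤ f i)
    argmax-exists (i₀ , Pi₀) =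
      argmax f i₀ candidates ,
      argmax-all f Pi₀ (All.all-filter P? (List.allFin n)) ,
      λ j Pj → All.lookup (f[xs]≤f[argmax] i₀ candidates) (List.∈-filter⁺ P? (List.∈-allFin j) Pj)
      where open Extrema totalOrder

    argmin-exists : ∃ P → ∃[ i ] (P i × ∀ j → P j → f i ≤ f j)
    argmin-exists (i₀ , Pi₀) =
      argmin f i₀ candidates ,
      argmin-all f Pi₀ (All.all-filter P? (List.allFin n)) ,
      λ j Pj → All.lookup (f[argmin]≤f[xs] i₀ candidates) (List.∈-filter⁺ P? (List.∈-allFin j) Pj)
      where open Extrema totalOrder

  -- There are only finitely many values below `q`, so a gap remains under `q`. The induction splits
  -- the subsets by their first element and takes the larger of the two bounds. It serves to move a
  -- quota off all coalition weights.
  <-separates : ∀ {p} {P : Pred (Subset n) p} → Decidable P → (f : Subset n → Carrier) →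
                ∀ {q} → (∀ A → P A → f A < q) → ∃[ q′ ] (q′ < q × (∀ A → P A → f A < q′))
  <-separates {zero} P? f {q} f<q with P? []
  ... | yes P[] = let (z , f[]<z , z<q) = <-dense (f<q [] P[]) in z , z<q , λ { [] _ → f[]<z }
  -- No value has to be bounded here, so any number below `q` will do.
  ... | no ¬P[] = q - 1# , x-1<x q , λ { [] P[] → contradiction P[] ¬P[] }
  <-separates {suc n} P? f f<q
    with <-separates (P? ∘ (inside ∷_)) (f ∘ (inside ∷_)) (f<q ∘ (inside ∷_))
       | <-separates (P? ∘ (outside ∷_)) (f ∘ (outside ∷_)) (f<q ∘ (outside ∷_))
  ... | q₁ , q₁<q , f<q₁ | q₂ , q₂<q , f<q₂ = q₁ ⊔ q₂ , ⊔-lub-< q₁<q q₂<q , λ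
    { (inside  ∷ A) PA → <-≤-trans (f<q₁ A PA) (x≤x⊔y q₁ q₂)
    ; (outside ∷ A) PA → <-≤-trans (f<q₂ A PA) (x≤y⊔x q₁ q₂)
    }

-- Finite sums, unit vectors and weights of coalitions.

module Sums {r} (ℝ : RealField r) where
  open RealField ℝ hiding (zero)
  open Geometry ℝ
  open OrderedField ℝ
  open SemiringSum semiring public
  open ≤-Reasoning strictPartialOrder

  sum-0 : ∀ {f : Vector Carrier n} → (∀ i → f i ≈ 0#) → sum f ≈ 0#
  sum-0 {n} f≈0 = trans (sum-cong-≋ f≈0) (sum-replicate-zero n)

  sum-neg : (f : Vector Carrier n) → sum (λ i → - f i) ≈ - sum f
  sum-neg {zero}  f = sym -0#≈0#
  sum-neg {suc n} f = trans (+-congˡ (sum-neg (f ∘ suc))) (-‿+-comm _ _)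

  sum-minus : (f g : Vector Carrier n) → sum (λ i → f i - g i) ≈ sum f - sum g
  sum-minus f g = trans (∑-distrib-+ f (λ i → - g i)) (+-congˡ (sum-neg g))

  sum-mono-≤ : ∀ {f g : Vector Carrier n} → (∀ i → f i ≤ g i) → sum f ≤ sum g
  sum-mono-≤ {zero}  f≤g = ≤-refl
  sum-mono-≤ {suc n} f≤g = +-mono-≤ (f≤g zero) (sum-mono-≤ (f≤g ∘ suc))

  sum-mono-< : ∀ {f g : Vector Carrier n} → (∀ i → f i ≤ g i) → ∀ i → f i < g i → sum f < sum g
  sum-mono-< f≤g zero    fi<gi = +-mono-<-≤ fi<gi (sum-mono-≤ (f≤g ∘ suc))
  sum-mono-< f≤g (suc i) fi<gi = +-mono-≤-< (f≤g zero) (sum-mono-< (f≤g ∘ suc) i fi<gi)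

  -- One strict term would make the sums strictly ordered, so the equality case of `sum-mono-≤`
  -- forces equality in every term.
  sum-tight : ∀ {f g : Vector Carrier n} → (∀ i → f i ≤ g i) → sum g ≤ sum f → ∀ i → g i ≤ f i
  sum-tight f≤g Σg≤Σf i = ≮⇒≥ λ fi<gi → ≤⇒≯ Σg≤Σf (sum-mono-< f≤g i fi<gi)

  e-sym : (i j : Fin n) → e i j ≡ e j i
  e-sym i j with i ≟ j | j ≟ i
  ... | yes _   | yes _   = ≡.refl
  ... | no  _   | no  _   = ≡.refl
  ... | yes i≡j | no  j≢i = contradiction (≡.sym i≡j) j≢i
  ... | no  i≢j | yes j≡i = contradiction (≡.sym j≡i) i≢j

  e-diag : (i : Fin n) → e i i ≡ 1#
  e-diag i rewrite dec-true (i ≟ i) ≡.refl = ≡.refl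

  e-off : ∀ {i j : Fin n} → i ≢ j → e i j ≡ 0#
  e-off {i = i} {j} i≢j rewrite dec-false (i ≟ j) i≢j = ≡.refl

  0≤e : ∀ (i k : Fin n) → 0# ≤ e i k
  0≤e i k with does (i ≟ k)
  ... | true  = inj₁ 0<1
  ... | false = ≤-refl

  sum-*e : (f : Vector Carrier n) (i : Fin n) → sum (λ k → f k * e i k) ≈ f i
  sum-*e {suc n} f zero = begin-equality
    f zero * 1# + sum (λ k → f (suc k) * 0#)  ≈⟨ +-cong (*-identityʳ (f zero)) (sum-0 (λ k → zeroʳ (f (suc k)))) ⟩
    f zero + 0#                               ≈⟨ +-identityʳ (f zero) ⟩
    f zero                                    ∎
  sum-*e {suc n} f (suc i) = begin-equality
    f zero * 0# + sum (λ k → f (suc k) * e i k)  ≈⟨ +-cong (zeroʳ (f zero)) (sum-*e (f ∘ suc) i) ⟩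
    0# + f (suc i)                               ≈⟨ +-identityˡ (f (suc i)) ⟩
    f (suc i)                                    ∎

  sum-e : (i : Fin n) → sum (e i) ≈ 1#
  sum-e i = trans (sum-cong-≋ (λ k → sym (*-identityˡ (e i k)))) (sum-*e (λ _ → 1#) i)

  restrict : Subset n → Vector Carrier n → Vector Carrier n
  restrict A f i = if lookup A i then f i else 0#

  -- The vector `y` is the restriction of `w` to `A` plus `y i` times the unit vector at `i`. The
  -- value `y i` is left free: at a pivot it is the remainder between the quota and the weight of
  -- `A`.
  sumOver-split : ∀ {w y : Vector Carrier n} {A i} → i ∉ A →
                  (∀ k → k ∈ A → y k ≈ w k) → (∀ k → k ∉ A → k ≢ i → y k ≈ 0#) →
                  sum y ≈ sumOver A w + y i
  sumOver-split {w = w} {y} {A} {i} i∉A y≈w y≈0 = begin-equality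
    sum y                                        ≈⟨ sum-cong-≋ pointwise ⟩
    sum (λ k → restrict A w k + y k * e i k)     ≈⟨ ∑-distrib-+ (restrict A w) (λ k → y k * e i k) ⟩
    sumOver A w + sum (λ k → y k * e i k)        ≈⟨ +-congˡ (sum-*e y i) ⟩
    sumOver A w + y i                            ∎
    where
    pointwise : ∀ k → y k ≈ restrict A w k + y k * e i k
    pointwise k with k ≟ i
    ... | yes ≡.refl = begin-equality
      y k                             ≈⟨ +-identityˡ (y k) ⟨
      0# + y k                        ≈⟨ +-cong (reflexive (if-∉ i∉A)) (*-identityʳ (y k)) ⟨
      restrict A w k + y k * 1#       ≡⟨ ≡.cong (λ t → restrict A w k + y k * t) (e-diag k) ⟨
      restrict A w k + y k * e k k    ∎
    ... | no k≢i = begin-equality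
      y k                             ≈⟨ yk ⟩
      restrict A w k                  ≈⟨ +-identityʳ _ ⟨
      restrict A w k + 0#             ≈⟨ +-congˡ (zeroʳ (y k)) ⟨
      restrict A w k + y k * 0#       ≡⟨ ≡.cong (λ t → restrict A w k + y k * t) (e-off (k≢i ∘ ≡.sym)) ⟨
      restrict A w k + y k * e i k    ∎
      where
      yk : y k ≈ restrict A w k
      yk with k ∈? A
      ... | yes k∈A = trans (y≈w k k∈A) (reflexive (≡.sym (if-∈ k∈A)))
      ... | no  k∉A = trans (y≈0 k k∉A k≢i) (reflexive (≡.sym (if-∉ k∉A)))

  sumOver-∪⁅⁆ : ∀ (w : Vector Carrier n) {A i} → i ∉ A → sumOver (A ∪ ⁅ i ⁆) w ≈ sumOver A w + w i
  sumOver-∪⁅⁆ w {A} {i} i∉A = trans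
    (sumOver-split i∉A
      (λ k k∈A → reflexive (if-∈ (p⊆p∪q ⁅ i ⁆ k∈A)))
      (λ k k∉A k≢i → reflexive (if-∉ (i∉p∪⁅j⁆ k∉A k≢i))))
    (+-congˡ (reflexive (if-∈ (x∈p∪⁅x⁆ A i))))

  sumOver-mono-⊆ : ∀ {w : Vector Carrier n} {A B} → (∀ i → 0# ≤ w i) → A ⊆ B → sumOver A w ≤ sumOver B w
  sumOver-mono-⊆ {w = w} {A} {B} 0≤w A⊆B = sum-mono-≤ pointwise
    where
    pointwise : ∀ i → restrict A w i ≤ restrict B w i
    pointwise i with i ∈? A | i ∈? B
    ... | yes i∈A | _       = ≤-reflexive (reflexive (≡.trans (if-∈ i∈A) (≡.sym (if-∈ (A⊆B i∈A)))))
    ... | no  i∉A | yes i∈B = ≤-respˡ-≈ (reflexive (≡.sym (if-∉ i∉A)))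
                                (≤-respʳ-≈ (reflexive (≡.sym (if-∈ i∈B))) (0≤w i))
    ... | no  i∉A | no  i∉B = ≤-reflexive (reflexive (≡.trans (if-∉ i∉A) (≡.sym (if-∉ i∉B))))

  -- Constant vectors are orthogonal to `H₀`, so a functional may be measured from any level `c`.
  ⟨,⟩-H₀-shift : ∀ (u : Vector Carrier n) c {z} → H₀ z → ⟨ (λ k → u k - c) , z ⟩ ≈ ⟨ u , z ⟩
  ⟨,⟩-H₀-shift u c {z} Σz≈0 = begin-equality
    sum (λ k → (u k - c) * z k)           ≈⟨ sum-cong-≋ (λ k → [y-z]x≈yx-zx (z k) (u k) c) ⟩
    sum (λ k → u k * z k - c * z k)       ≈⟨ sum-minus (λ k → u k * z k) (λ k → c * z k) ⟩
    Σuz - sum (λ k → c * z k)             ≈⟨ +-congˡ (-‿cong (*-distribˡ-sum c z)) ⟨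
    Σuz - c * sum z                       ≈⟨ +-congˡ (-‿cong (trans (*-congˡ Σz≈0) (zeroʳ c))) ⟩
    Σuz - 0#                              ≈⟨ +-congˡ -0#≈0# ⟩
    Σuz + 0#                              ≈⟨ +-identityʳ Σuz ⟩
    Σuz                                   ∎
    where Σuz = sum (λ k → u k * z k)

-- Cones of the canonical fan, described by inequalities.

module Cones {r} (ℝ : RealField r) where
  open RealField ℝ hiding (zero)
  open Geometry ℝ
  open OrderedField ℝ
  open Sums ℝ
  open SemiringMult semiring using (×-congʳ; ×-assoc-*) renaming (_×_ to _·_)
  open ≤-Reasoning strictPartialOrder

  ν : ℕ → Carrier
  ν n = (n · 1#) ⁻¹

  mean-const : ∀ n .{{_ : NonZero n}} c → ν n * sum {n} (λ _ → c) ≈ c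
  mean-const n c = begin-equality
    ν n * sum {n} (λ _ → c)  ≈⟨ *-congˡ (sum-replicate n) ⟩
    ν n * (n · c)            ≈⟨ *-congˡ (×-congʳ n (*-identityˡ c)) ⟨
    ν n * (n · (1# * c))     ≈⟨ *-congˡ (×-assoc-* n 1# c) ⟨
    ν n * (n · 1# * c)       ≈⟨ *-assoc (ν n) (n · 1#) c ⟨
    ν n * (n · 1#) * c       ≈⟨ *-congʳ (*-comm (ν n) (n · 1#)) ⟩
    n · 1# * ν n * c         ≈⟨ *-congʳ (⁻¹-inverse λ n≈0 → <-irrefl (sym n≈0) (0<n·1 n)) ⟩
    1# * c                   ≈⟨ *-identityˡ c ⟩
    c                        ∎

  -- For nonzero `n` this is the orthogonal projection onto `H₀`.
  centre : Vector Carrier n → Vector Carrier n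
  centre {n} y k = y k - ν n * sum y

  centre-H₀ : .{{_ : NonZero n}} (y : Vector Carrier n) → H₀ (centre y)
  centre-H₀ {n} y = begin-equality
    sum (centre y)                             ≈⟨ sum-minus y (λ _ → ν n * sum y) ⟩
    sum y - sum {n} (λ _ → ν n * sum y)        ≈⟨ +-congˡ (-‿cong (*-distribˡ-sum {n} (ν n) (λ _ → sum y))) ⟨
    sum y - ν n * sum {n} (λ _ → sum y)        ≈⟨ +-congˡ (-‿cong (mean-const n (sum y))) ⟩
    sum y - sum y                              ≈⟨ -‿inverseʳ (sum y) ⟩
    0#                                         ∎

  -- The projection kills the constant vector `c` and fixes `x`.
  centre-shift : .{{_ : NonZero n}} {x y : Vector Carrier n} (c : Carrier) → H₀ x →
                 (∀ k → y k ≈ x k - c) → ∀ k → centre y k ≈ x k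
  centre-shift {n} {x} {y} c Σx≈0 y≈x-c k = begin-equality
    y k - ν n * sum y                        ≈⟨ +-cong (y≈x-c k) (-‿cong (*-congˡ Σy)) ⟩
    (x k - c) - ν n * (- sum {n} (λ _ → c))  ≈⟨ +-congˡ (-‿cong (-‿distribʳ-* (ν n) _)) ⟨
    (x k - c) - - (ν n * sum {n} (λ _ → c))  ≈⟨ +-congˡ (-‿involutive _) ⟩
    (x k - c) + ν n * sum {n} (λ _ → c)      ≈⟨ +-congˡ (mean-const n c) ⟩
    (x k - c) + c                            ≈⟨ [x-y]+y≈x (x k) c ⟩
    x k                                      ∎
    where
    Σy : sum y ≈ - sum {n} (λ _ → c)
    Σy = begin-equality
      sum y                        ≈⟨ sum-cong-≋ y≈x-c ⟩
      sum (λ k → x k - c)          ≈⟨ sum-minus x (λ _ → c) ⟩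
      sum x - sum {n} (λ _ → c)    ≈⟨ +-congʳ Σx≈0 ⟩
      0# - sum {n} (λ _ → c)       ≈⟨ +-identityˡ _ ⟩
      - sum {n} (λ _ → c)          ∎

  δ≈ : ∀ (i k : Fin n) → δ i k ≈ e k i - ν n
  δ≈ {n} i k = +-cong (reflexive (e-sym i k)) (-‿cong (begin-equality
    ν n * sum (λ j → e j k)  ≈⟨ *-congˡ (sum-cong-≋ (λ j → reflexive (e-sym j k))) ⟩
    ν n * sum (e k)          ≈⟨ *-congˡ (sum-e k) ⟩
    ν n * 1#                 ≈⟨ *-identityʳ (ν n) ⟩
    ν n                      ∎))

  -- Each `δ i` is the projection of `e i`, so by linearity a combination of generators is the
  -- projection of its vector of signed coefficients.
  combination-δ-δ̄ : ∀ (A B : Subset n) a b k →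
                    (combination A a δ ⊕ combination B b δ̄) k ≈
                    centre (λ i → restrict A a i - restrict B b i) k
  combination-δ-δ̄ {n} A B a b k = begin-equality
    sumOver A (λ i → a i * δ i k) + sumOver B (λ i → b i * δ̄ i k)
      ≈⟨ ∑-distrib-+ (restrict A (λ i → a i * δ i k)) (restrict B (λ i → b i * δ̄ i k)) ⟨
    sum (λ i → restrict A (λ i → a i * δ i k) i + restrict B (λ i → b i * δ̄ i k) i)
      ≈⟨ sum-cong-≋ pointwise ⟩
    sum (λ i → y i * e k i - y i * ν n)
      ≈⟨ sum-minus (λ i → y i * e k i) (λ i → y i * ν n) ⟩
    sum (λ i → y i * e k i) - sum (λ i → y i * ν n)
      ≈⟨ +-cong (sum-*e y k) (-‿cong (trans (sym (*-distribʳ-sum (ν n) y)) (*-comm (sum y) (ν n)))) ⟩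
    y k - ν n * sum y
      ∎
    where
    y : Vector Carrier n
    y i = restrict A a i - restrict B b i

    restrict-* : ∀ (A : Subset n) a d i → restrict A (λ i → a i * d i) i ≈ restrict A a i * d i
    restrict-* A a d i with lookup A i
    ... | true  = refl
    ... | false = sym (zeroˡ (d i))

    pointwise : ∀ i → restrict A (λ i → a i * δ i k) i + restrict B (λ i → b i * δ̄ i k) i ≈
                      y i * e k i - y i * ν n
    pointwise i = begin-equality
      restrict A (λ i → a i * δ i k) i + restrict B (λ i → b i * δ̄ i k) i
        ≈⟨ +-cong (restrict-* A a (λ i → δ i k) i) (restrict-* B b (λ i → δ̄ i k) i) ⟩
      restrict A a i * δ i k + restrict B b i * - δ i k
        ≈⟨ +-congˡ (-‿distribʳ-* (restrict B b i) (δ i k)) ⟨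
      restrict A a i * δ i k - restrict B b i * δ i k
        ≈⟨ [y-z]x≈yx-zx (δ i k) (restrict A a i) (restrict B b i) ⟨
      y i * δ i k
        ≈⟨ *-congˡ (δ≈ i k) ⟩
      y i * (e k i - ν n)
        ≈⟨ x[y-z]≈xy-xz (y i) (e k i) (ν n) ⟩
      y i * e k i - y i * ν n
        ∎

  -- At an index in neither set the two bounds force `x k ≈ c`; an index in just one of the sets
  -- keeps one bound.
  Cut : Subset n → Subset n → Carrier → Vector Carrier n → Set r
  Cut A₁ A₂ c x = ∀ k → (k ∉ A₂ → c ≤ x k) × (k ∉ A₁ → x k ≤ c)

  cone⇒H₀ : .{{_ : NonZero n}} → ∀ {A₁ A₂ : Subset n} {x} → cone A₁ A₂ x → H₀ x
  cone⇒H₀ {A₁ = A₁} {A₂} {x} (a , b , _ , _ , x≈) =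
    trans (sum-cong-≋ (λ k → trans (x≈ k) (combination-δ-δ̄ A₁ A₂ a b k))) (centre-H₀ _)

  cone⇒Cut : ∀ {A₁ A₂ : Subset n} {x} → cone A₁ A₂ x → ∃[ c ] Cut A₁ A₂ c x
  cone⇒Cut {n} {A₁} {A₂} {x} (a , b , 0≤a , 0≤b , x≈) = c , λ k → lower k , upper k
    where
    g h y : Vector Carrier n
    g = restrict A₁ a
    h = restrict A₂ b
    y i = g i - h i
    -- Projecting `y` adds this constant to every coordinate, so it is the level at which the sign
    -- of `y` changes.
    c = - (ν n * sum y)

    x≈y+c : ∀ k → x k ≈ y k + c
    x≈y+c k = trans (x≈ k) (combination-δ-δ̄ A₁ A₂ a b k)

    restrict≥0 : ∀ A {a : Vector Carrier n} → (∀ i → 0# ≤ a i) → ∀ k → 0# ≤ restrict A a k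
    restrict≥0 A 0≤a k with lookup A k
    ... | true  = 0≤a k
    ... | false = ≤-refl

    lower : ∀ k → k ∉ A₂ → c ≤ x k
    lower k k∉A₂ = begin
      c                ≈⟨ +-identityˡ c ⟨
      0# + c           ≤⟨ +-monoˡ-≤ c (restrict≥0 A₁ 0≤a k) ⟩
      g k + c          ≈⟨ +-congʳ (trans (+-congˡ -0#≈0#) (+-identityʳ (g k))) ⟨
      (g k - 0#) + c   ≡⟨ ≡.cong (λ t → (g k - t) + c) (if-∉ k∉A₂) ⟨
      y k + c          ≈⟨ x≈y+c k ⟨
      x k              ∎

    upper : ∀ k → k ∉ A₁ → x k ≤ c
    upper k k∉A₁ = begin
      x k              ≈⟨ x≈y+c k ⟩
      y k + c          ≡⟨ ≡.cong (λ t → (t - h k) + c) (if-∉ k∉A₁) ⟩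
      (0# - h k) + c   ≤⟨ +-monoˡ-≤ c (+-monoʳ-≤ 0# (-‿anti-mono-≤ (restrict≥0 A₂ 0≤b k))) ⟩
      (0# - 0#) + c    ≈⟨ +-congʳ (-‿inverseʳ 0#) ⟩
      0# + c           ≈⟨ +-identityˡ c ⟩
      c                ∎

  Cut⇒cone : .{{_ : NonZero n}} → ∀ {A₁ A₂ : Subset n} {c x} → H₀ x → Cut A₁ A₂ c x → cone A₁ A₂ x
  Cut⇒cone {n} {A₁} {A₂} {c} {x} Σx≈0 cut =
    -- The coefficients are the positive and negative parts of `x - c`. The cut makes the first
    -- vanish off `A₁` and the second off `A₂`, so restricting them loses nothing.
    (λ k → pos (y k)) , (λ k → pos (- y k)) , (λ k → x≤y⊔x _ _) , (λ k → x≤y⊔x _ _) ,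
    λ k → sym (trans (combination-δ-δ̄ A₁ A₂ _ _ k) (centre-shift c Σx≈0 g-h≈y k))
    where
    y : Vector Carrier n
    y k = x k - c

    pos : Carrier → Carrier
    pos z = z ⊔ 0#

    pos-restrict : ∀ A (z : Vector Carrier n) k → (k ∉ A → z k ≤ 0#) →
                   restrict A (λ k → pos (z k)) k ≈ pos (z k)
    pos-restrict A z k z≤0 with k ∈? A
    ... | yes k∈A = reflexive (if-∈ k∈A)
    ... | no  k∉A = trans (reflexive (if-∉ k∉A)) (sym (x≤y⇒x⊔y≈y (z≤0 k∉A)))

    pos-neg : ∀ z → pos z - pos (- z) ≈ z
    pos-neg z with compare z 0#
    ... | tri< z<0 _ _ = begin-equality
      pos z - pos (- z)  ≈⟨ +-cong (x≤y⇒x⊔y≈y (inj₁ z<0)) (-‿cong (x≥y⇒x⊔y≈x 0≤-z)) ⟩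
      0# - - z           ≈⟨ +-identityˡ _ ⟩
      - - z              ≈⟨ -‿involutive z ⟩
      z                  ∎
      where
      0≤-z : 0# ≤ - z
      0≤-z = ≤-respˡ-≈ -0#≈0# (-‿anti-mono-≤ (inj₁ z<0))
    ... | tri≈ _ z≈0 _ = begin-equality
      pos z - pos (- z)  ≈⟨ +-cong (x≤y⇒x⊔y≈y (inj₂ z≈0)) (-‿cong (x≤y⇒x⊔y≈y (inj₂ (trans (-‿cong z≈0) -0#≈0#)))) ⟩
      0# - 0#            ≈⟨ -‿inverseʳ 0# ⟩
      0#                 ≈⟨ z≈0 ⟨
      z                  ∎
    ... | tri> _ _ 0<z = begin-equality
      pos z - pos (- z)  ≈⟨ +-cong (x≥y⇒x⊔y≈x (inj₁ 0<z)) (-‿cong (x≤y⇒x⊔y≈y -z≤0)) ⟩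
      z - 0#             ≈⟨ +-congˡ -0#≈0# ⟩
      z + 0#             ≈⟨ +-identityʳ z ⟩
      z                  ∎
      where
      -z≤0 : - z ≤ 0#
      -z≤0 = ≤-respʳ-≈ -0#≈0# (-‿anti-mono-≤ (inj₁ 0<z))

    y≤0 : ∀ k → k ∉ A₁ → y k ≤ 0#
    y≤0 k k∉A₁ = ≤-respʳ-≈ (-‿inverseʳ c) (+-monoˡ-≤ (- c) (proj₂ (cut k) k∉A₁))

    -y≤0 : ∀ k → k ∉ A₂ → - y k ≤ 0#
    -y≤0 k k∉A₂ = ≤-respʳ-≈ -0#≈0# (-‿anti-mono-≤
      (≤-respˡ-≈ (-‿inverseʳ c) (+-monoˡ-≤ (- c) (proj₁ (cut k) k∉A₂))))

    g-h≈y : ∀ k → restrict A₁ (λ k → pos (y k)) k - restrict A₂ (λ k → pos (- y k)) k ≈ x k - c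
    g-h≈y k = trans
      (+-cong (pos-restrict A₁ y k (y≤0 k)) (-‿cong (pos-restrict A₂ (λ k → - y k) k (-y≤0 k))))
      (pos-neg (y k))

-- Linear functionals on polytopes in `H₀`.

module Polytopes {r} (ℝ : RealField r) where
  open RealField ℝ hiding (zero)
  open Geometry ℝ
  open OrderedField ℝ
  open Sums ℝ
  open Cones ℝ
  open ≤-Reasoning strictPartialOrder

  -- `δ i` differs from `e i` by a constant vector, which is invisible on `H₀`.
  ⟨δ,⟩ : ∀ (i : Fin n) {z} → H₀ z → ⟨ δ i , z ⟩ ≈ z i
  ⟨δ,⟩ {n} i {z} Σz≈0 = begin-equality
    sum (λ k → δ i k * z k)          ≈⟨ sum-cong-≋ (λ k → *-congʳ (trans (δ≈ i k) (+-congʳ (reflexive (e-sym k i))))) ⟩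
    sum (λ k → (e i k - ν n) * z k)  ≈⟨ ⟨,⟩-H₀-shift (e i) (ν n) Σz≈0 ⟩
    sum (λ k → e i k * z k)          ≈⟨ sum-cong-≋ (λ k → *-comm (e i k) (z k)) ⟩
    sum (λ k → z k * e i k)          ≈⟨ sum-*e z i ⟩
    z i                              ∎

  ⟨δ̄,⟩ : ∀ (i : Fin n) {z} → H₀ z → ⟨ δ̄ i , z ⟩ ≈ - z i
  ⟨δ̄,⟩ i {z} Σz≈0 = begin-equality
    sum (λ k → - δ i k * z k)    ≈⟨ sum-cong-≋ (λ k → -‿distribˡ-* (δ i k) (z k)) ⟨
    sum (λ k → - (δ i k * z k))  ≈⟨ sum-neg (λ k → δ i k * z k) ⟩
    - sum (λ k → δ i k * z k)    ≈⟨ -‿cong (⟨δ,⟩ i Σz≈0) ⟩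
    - z i                        ∎

  module _ {m} {c f : Vector Carrier m} (0≤c : ∀ i → 0# ≤ c i) (Σc≈1 : sum c ≈ 1#) where

    average-const : ∀ b → sum (λ i → c i * b) ≈ b
    average-const b = trans (sym (*-distribʳ-sum b c)) (trans (*-congʳ Σc≈1) (*-identityˡ b))

    average-≤ : ∀ {b} → (∀ i → f i ≤ b) → sum (λ i → c i * f i) ≤ b
    average-≤ {b} f≤b = ≤-respʳ-≈ (average-const b) (sum-mono-≤ λ i → *-monoˡ-≤-nonNeg (0≤c i) (f≤b i))

    average-≥ : ∀ {b} → (∀ i → b ≤ f i) → b ≤ sum (λ i → c i * f i)
    average-≥ {b} b≤f = ≤-respˡ-≈ (average-const b) (sum-mono-≤ λ i → *-monoˡ-≤-nonNeg (0≤c i) (b≤f i))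

  module _ (P : Polytope n) where
    open Polytope P

    point∈hull : ∀ i → hull P (point i)
    point∈hull i = e i , 0≤e i , sum-e i , λ k → sym (trans
      (sum-cong-≋ (λ j → *-comm (e i j) (point j k))) (sum-*e (λ j → point j k) i))

    hull⊆H₀ : ∀ {x} → hull P x → H₀ x
    hull⊆H₀ {x} (c , _ , _ , x≈) = begin-equality
      sum x                                      ≈⟨ sum-cong-≋ x≈ ⟩
      sum (λ k → sum (λ i → c i * point i k))    ≈⟨ ∑-comm (λ k i → c i * point i k) ⟩
      sum (λ i → sum (λ k → c i * point i k))    ≈⟨ sum-0 (λ i → trans (sym (*-distribˡ-sum (c i) (point i)))
                                                                  (trans (*-congˡ (inH₀ i)) (zeroʳ (c i)))) ⟩
      0#                                         ∎

    hull-⟨,⟩≤ : ∀ (y : Vector Carrier n) {x b} → hull P x → (∀ i → ⟨ y , point i ⟩ ≤ b) → ⟨ y , x ⟩ ≤ b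
    hull-⟨,⟩≤ y {x} {b} (c , 0≤c , Σc≈1 , x≈) y≤b = begin
      sum (λ k → y k * x k)                            ≈⟨ sum-cong-≋ expand ⟩
      sum (λ k → sum (λ i → y k * (c i * point i k)))  ≈⟨ ∑-comm (λ k i → y k * (c i * point i k)) ⟩
      sum (λ i → sum (λ k → y k * (c i * point i k)))  ≈⟨ sum-cong-≋ factor ⟩
      sum (λ i → c i * sum (λ k → y k * point i k))    ≤⟨ average-≤ 0≤c Σc≈1 y≤b ⟩
      b                                                ∎
      where
      exchange : ∀ a b c → a * (b * c) ≈ b * (a * c)
      exchange a b c = trans (sym (*-assoc a b c)) (trans (*-congʳ (*-comm a b)) (*-assoc b a c))

      expand : ∀ k → y k * x k ≈ sum (λ i → y k * (c i * point i k))
      expand k = trans (*-congˡ (x≈ k)) (*-distribˡ-sum (y k) (λ i → c i * point i k))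

      factor : ∀ i → sum (λ k → y k * (c i * point i k)) ≈ c i * sum (λ k → y k * point i k)
      factor i = trans (sum-cong-≋ (λ k → exchange (y k) (c i) (point i k)))
                       (sym (*-distribˡ-sum (c i) (λ k → y k * point i k)))

    -- A bound valid at the generating points passes to their convex combinations, so the best of
    -- these points maximises over the hull.
    maximiser-exists : Satisfiable (hull P) → ∀ y → Satisfiable (maximisers P y)
    maximiser-exists (_ , c , _ , Σc≈1 , _) y
      with argmax-exists U? (λ i → ⟨ y , point i ⟩) (decidable-stable (any? U?) nonempty)
      where
      nonempty : ¬ ¬ ∃ U
      -- Without generating points the coefficients of a hull point would sum to 0 instead of 1.
      nonempty empty = 0≉1 (trans (sym (sum-0 λ i → contradiction (i , _) empty)) Σc≈1)
    ... | i , _ , max = point i , point∈hull i , λ z z∈ → hull-⟨,⟩≤ y z∈ (λ j → max j _)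

-- Enumeration of all coalitions.

subsets : ∀ n → List.List (Subset n)
subsets zero    = [] List.∷ List.[]
subsets (suc n) = List.map (inside ∷_) (subsets n) List.++ List.map (outside ∷_) (subsets n)

∈-subsets : (A : Subset n) → A List.∈ subsets n
∈-subsets []            = Any.here ≡.refl
∈-subsets (inside  ∷ A) = List.∈-++⁺ˡ (List.∈-map⁺ (inside ∷_) (∈-subsets A))
∈-subsets (outside ∷ A) = List.∈-++⁺ʳ _ (List.∈-map⁺ (outside ∷_) (∈-subsets A))

-- Levels: locating a vector in the fan.

module Levels {r} (ℝ : RealField r) where
  open RealField ℝ hiding (zero)
  open Geometry ℝ
  open OrderedField ℝ
  open Sums ℝ using (sum)
  open Cones ℝ

  -- Together the fields say that `A₁` is `{u > c}` and `A₂` is `{u < c}`. For `u` in `H₀` this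
  -- places `u` in the relative interior of `cone A₁ A₂`.
  record IsLevel {n} (u : Vector Carrier n) (c : Carrier) (A₁ A₂ : Subset n) : Set r where
    field
      above  : ∀ {k} → k ∈ A₁ → c < u k
      ≤level : ∀ {k} → k ∉ A₁ → u k ≤ c
      below  : ∀ {k} → k ∈ A₂ → u k < c
      ≥level : ∀ {k} → k ∉ A₂ → c ≤ u k

    disjoint : A₁ ⊆ ∁ A₂
    disjoint k∈A₁ = x∉p⇒x∈∁p λ k∈A₂ → <-asym (above k∈A₁) (below k∈A₂)

  -- The witness is the sum of the generators of the cone: the projection of the vector `s` with
  -- values 1 on `A₁`, -1 on `A₂` and 0 elsewhere. Projecting moves its level from 0 to `c`.
  strictSeparation : ∀ (A₁ A₂ : Subset n) → A₁ ⊆ ∁ A₂ → .{{_ : NonZero n}} →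
                     ∃₂ λ u c → H₀ u × IsLevel u c A₁ A₂
  strictSeparation {n} A₁ A₂ A₁⊆∁A₂ = centre s , c , centre-H₀ s , record
    { above  = λ k∈A₁ → <-respˡ-≈ (+-identityˡ c)
        (+-monoˡ-< c (<-respʳ-≈ (reflexive (≡.sym (if-∈ k∈A₁))) 0<1))
    ; ≤level = λ k∉A₁ → ≤-respʳ-≈ (+-identityˡ c)
        (+-monoˡ-≤ c (≤-respˡ-≈ (reflexive (≡.sym (if-∉ k∉A₁))) (inner≤0 _)))
    ; below  = λ k∈A₂ → <-respʳ-≈ (+-identityˡ c)
        (+-monoˡ-< c (<-respˡ-≈ (reflexive (≡.sym (s≡-1 k∈A₂))) -1<0))
    ; ≥level = λ k∉A₂ → ≤-respˡ-≈ (+-identityˡ c) (+-monoˡ-≤ c (s≥0 _ k∉A₂))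
    }
    where
    s : Vector Carrier n
    s k = if lookup A₁ k then 1# else if lookup A₂ k then - 1# else 0#
    c = - (ν n * sum s)

    s≡-1 : ∀ {k} → k ∈ A₂ → s k ≡ - 1#
    s≡-1 k∈A₂ = ≡.trans (if-∉ λ k∈A₁ → x∈∁p⇒x∉p (A₁⊆∁A₂ k∈A₁) k∈A₂) (if-∈ k∈A₂)

    inner≤0 : ∀ k → (if lookup A₂ k then - 1# else 0#) ≤ 0#
    inner≤0 k with lookup A₂ k
    ... | true  = inj₁ -1<0
    ... | false = ≤-refl

    s≥0 : ∀ k → k ∉ A₂ → 0# ≤ s k
    s≥0 k k∉A₂ with lookup A₁ k
    ... | true  = inj₁ 0<1
    ... | false = ≤-reflexive (reflexive (≡.sym (if-∉ k∉A₂)))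

  -- This is completeness of the fan. The level is the largest value `u k` whose upper set
  -- `{u ≥ u k}` is not a face. Such values exist because the upper set of the minimum of `u` is
  -- everything and `K` is proper.
  level-exists : ∀ (K : SimplicialComplex n) .{{_ : NonZero n}} → Proper K → ∀ u →
                 ∃[ c ] ∃[ A₁ ] ∃[ A₂ ] (IsLevel u c A₁ A₂ × face K A₁ × dualFace K A₂)
  level-exists {n} K proper u = c , A₁ , A₂ , level , A₁∈K , A₂∈K°
    where
    open SimplicialComplex K using (face?; ⊆-face; ∅-face)

    upper : Fin n → Subset n
    upper k = comprehension (λ j → u k ≤? u j)

    lowest : ∃[ k ] ¬ face K (upper k)
    lowest with argmin-exists U? u (fromℕ< (>-nonZero⁻¹ n) , _)
    ... | k , _ , uk≤u = k , λ upper∈K → proper λ A →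
      ⊆-face (λ {j} _ → ∈-comprehension⁺ (λ j → u k ≤? u j) (uk≤u j _)) upper∈K

    best = argmax-exists (λ k → ¬? (face? (upper k))) u lowest
    k₀ = proj₁ best
    c = u k₀
    A₁ A₂ : Subset n
    A₁ = comprehension (λ j → c <? u j)
    A₂ = comprehension (λ j → u j <? c)

    level : IsLevel u c A₁ A₂
    level = record
      { above  = ∈-comprehension⁻ (λ j → c <? u j)
      ; ≤level = λ k∉A₁ → ≮⇒≥ (k∉A₁ ∘ ∈-comprehension⁺ (λ j → c <? u j))
      ; below  = ∈-comprehension⁻ (λ j → u j <? c)
      ; ≥level = λ k∉A₂ → ≮⇒≥ (k∉A₂ ∘ ∈-comprehension⁺ (λ j → u j <? c))
      }
    open IsLevel level

    A₂∈K° : dualFace K A₂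
    A₂∈K° = proj₁ (proj₂ best) ∘ ⊆-face λ j∈ →
      x∉p⇒x∈∁p λ j∈A₂ → ≤⇒≯ (∈-comprehension⁻ (λ j → c ≤? u j) j∈) (below j∈A₂)

    A₁∈K : face K A₁
    A₁∈K with nonempty? A₁
    ... | no  empty = ≡.subst (face K) (≡.sym (Empty-unique empty)) ∅-face
    ... | yes nonempty with argmin-exists (_∈? A₁) u nonempty
    -- `A₁` lies in the upper set of its lowest element `j`. If `A₁` were not a face, neither would
    -- that upper set be, although `u j` exceeds the maximal such value `c`.
    ...   | j , j∈A₁ , u≥uj = decidable-stable (face? A₁) λ A₁∉K →
            let A₁⊆upper : A₁ ⊆ upper j
                A₁⊆upper {k} k∈A₁ = ∈-comprehension⁺ (λ k → u j ≤? u k) (u≥uj k k∈A₁)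
            in ≤⇒≯ (proj₂ (proj₂ best) j (A₁∉K ∘ ⊆-face A₁⊆upper)) (above j∈A₁)

-- From weights to a polytope: the sliced box.

module ThresholdFan {r} (ℝ : RealField r) where
  open RealField ℝ hiding (zero)
  open Geometry ℝ
  open OrderedField ℝ
  open Sums ℝ
  open Cones ℝ
  open Polytopes ℝ
  open Levels ℝ
  open ≤-Reasoning strictPartialOrder

  module _ {n} .{{_ : NonZero n}} (K : SimplicialComplex n) (proper : Proper K)
           (w : Vector Carrier n) (q : Carrier) (0<w : ∀ i → 0# < w i)
           (face<q : ∀ A → face K A → sumOver A w < q)
           (q<nonface : ∀ A → ¬ face K A → q < sumOver A w) where
    open SimplicialComplex K using (face?; ⊆-face)

    lo : Carrier
    lo = - (ν n * q)

    hi : Vector Carrier n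
    hi k = lo + w k

    lo<hi : ∀ k → lo < hi k
    lo<hi k = <-respˡ-≈ (+-identityʳ lo) (+-monoʳ-< lo (0<w k))

    -- The coordinate at `i` absorbs the remainder `q - sumOver A w`, which brings the coordinate
    -- sum to `n lo + q`, that is, to 0.
    vertex : Subset n → Fin n → Vector Carrier n
    vertex A i k = lo + (restrict A w k + (q - sumOver A w) * e i k)

    vertex-H₀ : ∀ A i → H₀ (vertex A i)
    vertex-H₀ A i = begin-equality
      sum (vertex A i)
        ≈⟨ ∑-distrib-+ (λ _ → lo) (λ k → restrict A w k + t * e i k) ⟩
      sum {n} (λ _ → lo) + sum (λ k → restrict A w k + t * e i k)
        ≈⟨ +-cong Σlo Σfill ⟩
      - q + q
        ≈⟨ -‿inverseˡ q ⟩
      0#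
        ∎
      where
      t = q - sumOver A w
      Σlo : sum {n} (λ _ → lo) ≈ - q
      Σlo = begin-equality
        sum {n} (λ _ → lo)         ≈⟨ sum-neg {n} (λ _ → ν n * q) ⟩
        - sum {n} (λ _ → ν n * q)  ≈⟨ -‿cong (*-distribˡ-sum {n} (ν n) (λ _ → q)) ⟨
        - (ν n * sum {n} (λ _ → q))  ≈⟨ -‿cong (mean-const n q) ⟩
        - q                        ∎
      Σfill : sum (λ k → restrict A w k + t * e i k) ≈ q
      Σfill = begin-equality
        sum (λ k → restrict A w k + t * e i k)  ≈⟨ ∑-distrib-+ (restrict A w) (λ k → t * e i k) ⟩
        sumOver A w + sum (λ k → t * e i k)     ≈⟨ +-congˡ (sum-*e (λ _ → t) i) ⟩
        sumOver A w + t                         ≈⟨ +-comm _ _ ⟩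
        t + sumOver A w                         ≈⟨ [x-y]+y≈x q (sumOver A w) ⟩
        q                                       ∎

    module _ {A i} (pivotal : Pivotal K A i) where

      private
        t = q - sumOver A w

        off-i : ∀ {k x} → k ≢ i → x + t * e i k ≈ x
        off-i {k} {x} k≢i = begin-equality
          x + t * e i k  ≡⟨ ≡.cong (λ z → x + t * z) (e-off (k≢i ∘ ≡.sym)) ⟩
          x + t * 0#     ≈⟨ +-congˡ (zeroʳ t) ⟩
          x + 0#         ≈⟨ +-identityʳ x ⟩
          x              ∎

      vertex-∈ : ∀ {k} → k ∈ A → vertex A i k ≈ hi k
      vertex-∈ {k} k∈A = +-congˡ (trans (off-i λ { ≡.refl → pivotal⇒∉ K pivotal k∈A }) (reflexive (if-∈ k∈A)))

      vertex-∉ : ∀ {k} → k ∉ A → k ≢ i → vertex A i k ≈ lo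
      vertex-∉ {k} k∉A k≢i = trans (+-congˡ (trans (off-i k≢i) (reflexive (if-∉ k∉A)))) (+-identityʳ lo)

      vertex-pivot : vertex A i i ≈ lo + t
      vertex-pivot = +-congˡ (begin-equality
        restrict A w i + t * e i i  ≡⟨ ≡.cong₂ (λ x z → x + t * z) (if-∉ (pivotal⇒∉ K pivotal)) (e-diag i) ⟩
        0# + t * 1#                 ≈⟨ +-identityˡ _ ⟩
        t * 1#                      ≈⟨ *-identityʳ t ⟩
        t                           ∎)

      lo<vertex-pivot : lo < vertex A i i
      lo<vertex-pivot = begin-strict
        lo            ≈⟨ +-identityʳ lo ⟨
        lo + 0#       <⟨ +-monoʳ-< lo (x<y⇒0<y-x (face<q A (proj₁ pivotal))) ⟩
        lo + t        ≈⟨ vertex-pivot ⟨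
        vertex A i i  ∎

      -- As `A ∪ ⁅ i ⁆` is not a face, its weight exceeds `q`, so the remainder is less than `w i`.
      -- With `lo<vertex-pivot`, the pivot coordinate is strictly inside its interval because no
      -- coalition meets the quota exactly.
      vertex-pivot<hi : vertex A i i < hi i
      vertex-pivot<hi = begin-strict
        vertex A i i                                ≈⟨ vertex-pivot ⟩
        lo + (q - sumOver A w)                      <⟨ +-monoʳ-< lo (+-monoˡ-< _ (q<nonface _ (proj₂ pivotal))) ⟩
        lo + (sumOver (A ∪ ⁅ i ⁆) w - sumOver A w)  ≈⟨ +-congˡ (+-congʳ A∪i) ⟩
        lo + ((w i + sumOver A w) - sumOver A w)    ≈⟨ +-congˡ (//-rightDividesʳ (sumOver A w) (w i)) ⟩
        lo + w i                                    ∎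
        where
        A∪i : sumOver (A ∪ ⁅ i ⁆) w ≈ w i + sumOver A w
        A∪i = trans (sumOver-∪⁅⁆ w (pivotal⇒∉ K pivotal)) (+-comm _ _)

    Box : Vector Carrier n → Set r
    Box x = ∀ k → lo ≤ x k × x k ≤ hi k

    vertex-Box : ∀ {A i} → Pivotal K A i → Box (vertex A i)
    vertex-Box {A} {i} pivotal k with k ∈? A | k ≟ i
    ... | _       | yes ≡.refl = inj₁ (lo<vertex-pivot pivotal) , inj₁ (vertex-pivot<hi pivotal)
    ... | yes k∈A | no  k≢i    = ≤-respʳ-≈ (sym (vertex-∈ pivotal k∈A)) (inj₁ (lo<hi k)) ,
                                 inj₂ (vertex-∈ pivotal k∈A)
    ... | no  k∉A | no  k≢i    = inj₂ (sym (vertex-∉ pivotal k∉A k≢i)) ,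
                                 ≤-respˡ-≈ (sym (vertex-∉ pivotal k∉A k≢i)) (inj₁ (lo<hi k))

    isPivotal? : Decidable (λ ((A , i) : Subset n × Fin n) → Pivotal K A i)
    isPivotal? (A , i) = pivotal? K A i

    pairs pivots : List.List (Subset n × Fin n)
    pairs  = List.cartesianProduct (subsets n) (List.allFin n)
    pivots = List.filter isPivotal? pairs

    pivots-pivotal : ∀ j → let (A , i) = List.lookup pivots j in Pivotal K A i
    pivots-pivotal j = proj₂ (List.∈-filter⁻ isPivotal? {xs = pairs} (List.∈-lookup j))

    P : Polytope n
    P = record
      { size  = List.length pivots
      ; point = λ j → let (A , i) = List.lookup pivots j in vertex A i
      ; inH₀  = λ j → let (A , i) = List.lookup pivots j in vertex-H₀ A i
      }

    vertex∈hull : ∀ {A i} → Pivotal K A i → hull P (vertex A i)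
    vertex∈hull {A} {i} pivotal =
      ≡.subst (λ (A , i) → hull P (vertex A i)) (≡.sym (Any.lookup-index ∈pivots)) (point∈hull P (Any.index ∈pivots))
      where
      ∈pivots : (A , i) List.∈ pivots
      ∈pivots = List.∈-filter⁺ isPivotal? (List.∈-cartesianProduct⁺ (∈-subsets A) (List.∈-allFin i)) pivotal

    hull⊆Box : ∀ {x} → hull P x → Box x
    hull⊆Box (c , 0≤c , Σc≈1 , x≈) k =
      ≤-respʳ-≈ (sym (x≈ k)) (average-≥ 0≤c Σc≈1 λ j → proj₁ (vertex-Box (pivots-pivotal j) k)) ,
      ≤-respˡ-≈ (sym (x≈ k)) (average-≤ 0≤c Σc≈1 λ j → proj₂ (vertex-Box (pivots-pivotal j) k))

    -- For `x` in the box this says that `x` maximises `⟨ d , _ ⟩` over the whole box; coordinates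
    -- where `d` vanishes are free.
    Extremal : Vector Carrier n → Vector Carrier n → Set r
    Extremal d x = ∀ k → (0# < d k → x k ≈ hi k) × (d k < 0# → x k ≈ lo)

    Extremal-≤ : ∀ {d x z} → Extremal d x → Box z → ∀ k → d k * z k ≤ d k * x k
    Extremal-≤ {d} {x} {z} ext box k with compare (d k) 0#
    ... | tri> _ _ 0<d = *-monoˡ-≤-nonNeg (inj₁ 0<d) (≤-respʳ-≈ (sym (proj₁ (ext k) 0<d)) (proj₂ (box k)))
    ... | tri≈ _ d≈0 _ = inj₂ (trans (vanish (z k)) (sym (vanish (x k))))
      where
      vanish : ∀ y → d k * y ≈ 0#
      vanish y = trans (*-congʳ d≈0) (zeroˡ y)
    ... | tri< d<0 _ _ with ≤-respˡ-≈ (sym (proj₂ (ext k) d<0)) (proj₁ (box k))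
    ...   | inj₁ x<z = inj₁ (*-monoˡ-<-neg d<0 x<z)
    ...   | inj₂ x≈z = inj₂ (*-congˡ (sym x≈z))

    -- The termwise bounds of `Extremal-≤` become equalities by `sum-tight`, and where `d k` is
    -- nonzero an equality determines `z k`.
    Extremal-tight : ∀ {d x z} → Extremal d x → Box z → ⟨ d , x ⟩ ≤ ⟨ d , z ⟩ → Extremal d z
    Extremal-tight {d} {x} {z} ext box dx≤dz k =
      (λ 0<d → ≤-antisym (proj₂ (box k)) (≮⇒≥ λ z<hi →
        ≤⇒≯ (tight k) (*-monoˡ-<-pos 0<d (<-respʳ-≈ (sym (proj₁ (ext k) 0<d)) z<hi)))) ,
      (λ d<0 → ≤-antisym (≮⇒≥ λ lo<z →
        ≤⇒≯ (tight k) (*-monoˡ-<-neg d<0 (<-respˡ-≈ (sym (proj₂ (ext k) d<0)) lo<z))) (proj₁ (box k)))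
      where
      tight : ∀ k → d k * x k ≤ d k * z k
      tight = sum-tight (Extremal-≤ ext box) dx≤dz

    module _ (u : Vector Carrier n) (c : Carrier) where

      shifted : Vector Carrier n
      shifted k = u k - c

      shift : ∀ {x} → hull P x → ⟨ shifted , x ⟩ ≈ ⟨ u , x ⟩
      shift x∈ = ⟨,⟩-H₀-shift u c (hull⊆H₀ P x∈)

      Extremal⇒maximiser : ∀ {x} → hull P x → Extremal shifted x → maximisers P u x
      Extremal⇒maximiser x∈ ext = x∈ , λ z z∈ → ≤-respˡ-≈ (shift z∈) (≤-respʳ-≈ (shift x∈)
        (sum-mono-≤ (Extremal-≤ ext (hull⊆Box z∈))))

      module _ {A₁ A₂} (level : IsLevel u c A₁ A₂) (A₁∈K : face K A₁) (A₂∈K° : dualFace K A₂) where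
        open IsLevel level

        -- The shifted functional is positive only on `A₁`, where the vertex is at the top, and
        -- negative only on `A₂`, where it is at the bottom. The pivot `i` is in neither set.
        vertex-Extremal : ∀ {B i} → Pivotal K B i → A₁ ⊆ B → B ∪ ⁅ i ⁆ ⊆ ∁ A₂ →
                          Extremal shifted (vertex B i)
        vertex-Extremal {B} {i} pivotal A₁⊆B B∪i⊆∁A₂ k = on-top , on-bottom
          where
          on-top : 0# < shifted k → vertex B i k ≈ hi k
          on-top 0<d = vertex-∈ pivotal (A₁⊆B (decidable-stable (k ∈? A₁) λ k∉A₁ →
            ≤⇒≯ (≤level k∉A₁) (0<y-x⇒x<y 0<d)))

          on-bottom : shifted k < 0# → vertex B i k ≈ lo
          on-bottom d<0 = vertex-∉ pivotal (k∉B∪i ∘ p⊆p∪q ⁅ i ⁆) λ { ≡.refl → k∉B∪i (x∈p∪⁅x⁆ B i) }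
            where
            k∉B∪i : k ∉ B ∪ ⁅ i ⁆
            k∉B∪i k∈ = ≤⇒≯ (≥level (x∈∁p⇒x∉p (B∪i⊆∁A₂ k∈))) (y-x<0⇒y<x d<0)

        ExtremalVertex : (Vector Carrier n → Set r) → Set r
        ExtremalVertex Q = ∃[ x ] (hull P x × Extremal shifted x × Q x)

        extremal-vertex : ∀ {B i} {Q : Vector Carrier n → Set r} → Pivotal K B i →
                          A₁ ⊆ B → B ∪ ⁅ i ⁆ ⊆ ∁ A₂ → Q (vertex B i) → ExtremalVertex Q
        extremal-vertex {B} {i} pivotal A₁⊆B B∪i⊆∁A₂ Qx =
          vertex B i , vertex∈hull pivotal , vertex-Extremal pivotal A₁⊆B B∪i⊆∁A₂ , Qx

        extremal-exists : ∃[ x ] (hull P x × Extremal shifted x)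
        extremal-exists with pivotal-between K A₁∈K A₂∈K° disjoint
        ... | B , i , A₁⊆B , B∪i⊆∁A₂ , pivotal = _ , vertex∈hull pivotal , vertex-Extremal pivotal A₁⊆B B∪i⊆∁A₂

        -- If `A₁ ∪ ⁅ k ⁆` is not a face, `k` is a pivot over `A₁` and its coordinate is strictly
        -- inside. Otherwise a pivot can be found whose face contains `k`, which puts the coordinate
        -- at the top.
        extremal-above-lo : ∀ {k} → k ∉ A₂ → ExtremalVertex (λ x → lo < x k)
        extremal-above-lo {k} k∉A₂ with face? (A₁ ∪ ⁅ k ⁆)
        ... | no A₁∪k∉K = extremal-vertex pivotal ⊆-refl A₁∪k⊆∁A₂ (lo<vertex-pivot pivotal)
          where
          pivotal = A₁∈K , A₁∪k∉K
          A₁∪k⊆∁A₂ = p∪⁅x⁆⊆q disjoint (x∉p⇒x∈∁p k∉A₂)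
        ... | yes A₁∪k∈K with pivotal-between K A₁∪k∈K A₂∈K° (p∪⁅x⁆⊆q disjoint (x∉p⇒x∈∁p k∉A₂))
        ...   | B , i , A₁∪k⊆B , B∪i⊆∁A₂ , pivotal =
          extremal-vertex pivotal (⊆-trans (p⊆p∪q ⁅ k ⁆) A₁∪k⊆B) B∪i⊆∁A₂
            (<-respʳ-≈ (sym (vertex-∈ pivotal (A₁∪k⊆B (x∈p∪⁅x⁆ A₁ k)))) (lo<hi k))

        A₁⊆∁A₂∖k : ∀ {k} → k ∉ A₁ → A₁ ⊆ ∁ A₂ ∖ k
        A₁⊆∁A₂∖k k∉A₁ j∈A₁ = x∈p∧x≢y⇒x∈p-y (disjoint j∈A₁) λ { ≡.refl → k∉A₁ j∈A₁ }

        -- The counterpart from above: either `k` is the pivot that completes `∁ A₂`, or a pivot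
        -- exists that avoids `k` altogether, which puts the coordinate at the bottom.
        extremal-below-hi : ∀ {k} → k ∉ A₁ → ExtremalVertex (λ x → x k < hi k)
        extremal-below-hi {k} k∉A₁ with face? (∁ A₂ ∖ k)
        ... | yes ∁A₂∖k∈K =
          extremal-vertex pivotal (A₁⊆∁A₂∖k k∉A₁) (p∪⁅x⁆⊆q (p─q⊆p (∁ A₂) ⁅ k ⁆) k∈∁A₂) (vertex-pivot<hi pivotal)
          where
          pivotal = ∁A₂∖k∈K , A₂∈K° ∘ ⊆-face (p⊆p∖i∪⁅i⁆ (∁ A₂) k)
          k∈∁A₂ : k ∈ ∁ A₂
          -- Otherwise removing `k` would change nothing, and the nonface `∁ A₂` would be a face.
          k∈∁A₂ = decidable-stable (k ∈? ∁ A₂) λ k∉ →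
            A₂∈K° (⊆-face (λ j∈ → x∈p∧x≢y⇒x∈p-y j∈ λ { ≡.refl → k∉ j∈ }) ∁A₂∖k∈K)
        ... | no ∁A₂∖k∉K with pivotal-between K A₁∈K ∁A₂∖k∉K (A₁⊆∁A₂∖k k∉A₁)
        ...   | B , i , A₁⊆B , B∪i⊆ , pivotal =
          extremal-vertex pivotal A₁⊆B (⊆-trans B∪i⊆ (p─q⊆p (∁ A₂) ⁅ k ⁆))
            (<-respˡ-≈ (sym (vertex-∉ pivotal (k∉B∪i ∘ p⊆p∪q ⁅ i ⁆) λ { ≡.refl → k∉B∪i (x∈p∪⁅x⁆ B i) }))
              (lo<hi k))
          where
          k∉B∪i : k ∉ B ∪ ⁅ i ⁆
          k∉B∪i = i∉p∖i (∁ A₂) k ∘ B∪i⊆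

        -- An extremal vertex is available for comparison: the maximiser `x` does at least as well,
        -- so `Extremal-tight` applies.
        maximiser⇒Extremal : ∀ {x} → maximisers P u x → Extremal shifted x
        maximiser⇒Extremal (x∈ , max) with extremal-exists
        ... | z , z∈ , ext = Extremal-tight ext (hull⊆Box x∈)
          (≤-respˡ-≈ (sym (shift z∈)) (≤-respʳ-≈ (sym (shift x∈)) (max z z∈)))

    -- If `y` is in the normal cone, every extremal vertex for `u` is extremal for `y` at the level
    -- `c′` of `y`. A value `y k < c′` with `k ∉ A₂` would send all of them to the bottom at `k`,
    -- against `extremal-above-lo`; the upper bound is symmetric. Conversely, a cut of `y` gives
    -- `y - c′` a nonzero sign only where `u - c` has the same sign.
    normalCone≐cone : ∀ {u c A₁ A₂} → IsLevel u c A₁ A₂ → face K A₁ → dualFace K A₂ →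
                      normalCone P (maximisers P u) ≐ cone A₁ A₂
    normalCone≐cone {u} {c} {A₁} {A₂} level A₁∈K A₂∈K° = normal⊆ , ⊆normal
      where
      normal⊆ : ∀ {y} → normalCone P (maximisers P u) y → cone A₁ A₂ y
      normal⊆ {y} (Σy≈0 , max) with level-exists K proper y
      ... | c′ , B₁ , B₂ , levelʸ , B₁∈K , B₂∈K° = Cut⇒cone Σy≈0 λ k → lower k , upper k
        where
        Extremalʸ : ∀ {x} → hull P x → Extremal (shifted u c) x → Extremal (shifted y c′) x
        Extremalʸ x∈ ext = maximiser⇒Extremal y c′ levelʸ B₁∈K B₂∈K° (max _ (Extremal⇒maximiser u c x∈ ext))

        lower : ∀ k → k ∉ A₂ → c′ ≤ y k
        lower k k∉A₂ = ≮⇒≥ λ yk<c′ →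
          let (x , x∈ , ext , lo<x) = extremal-above-lo u c level A₁∈K A₂∈K° k∉A₂
          in <-irrefl (sym (proj₂ (Extremalʸ x∈ ext k) (y<x⇒y-x<0 yk<c′))) lo<x

        upper : ∀ k → k ∉ A₁ → y k ≤ c′
        upper k k∉A₁ = ≮⇒≥ λ c′<yk →
          let (x , x∈ , ext , x<hi) = extremal-below-hi u c level A₁∈K A₂∈K° k∉A₁
          in <-irrefl (proj₁ (Extremalʸ x∈ ext k) (x<y⇒0<y-x c′<yk)) x<hi

      open IsLevel level

      ⊆normal : ∀ {y} → cone A₁ A₂ y → normalCone P (maximisers P u) y
      ⊆normal {y} y∈ with cone⇒Cut {A₁ = A₁} {A₂} y∈
      ... | c′ , cut = cone⇒H₀ {A₁ = A₁} {A₂} y∈ , λ x max → Extremal⇒maximiser y c′ (proj₁ max) λ k →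
        (λ 0<d → proj₁ (maximiser⇒Extremal u c level A₁∈K A₂∈K° max k)
          (x<y⇒0<y-x (above (decidable-stable (k ∈? A₁) λ k∉A₁ →
            ≤⇒≯ (proj₂ (cut k) k∉A₁) (0<y-x⇒x<y 0<d))))) ,
        (λ d<0 → proj₂ (maximiser⇒Extremal u c level A₁∈K A₂∈K° max k)
          (y<x⇒y-x<0 (below (decidable-stable (k ∈? A₂) λ k∉A₂ →
            ≤⇒≯ (proj₁ (cut k) k∉A₂) (y-x<0⇒y<x d<0)))))

    -- A cone of the fan is the normal cone at a functional from its relative interior, given by
    -- `strictSeparation`. Conversely, the level of a functional names the cone to which its normal
    -- cone is equal.
    canonicalFan≐normalFan : canonicalFan K ≐ normalFan P
    canonicalFan≐normalFan = canonical⊆ , normal⊆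
      where
      canonical⊆ : ∀ {C} → canonicalFan K C → normalFan P C
      canonical⊆ (A₁ , A₂ , A₁∈K , A₂∈K° , A₁∩A₂≡⊥ , C≐) with strictSeparation A₁ A₂ A₁⊆∁A₂
        where
        A₁⊆∁A₂ : A₁ ⊆ ∁ A₂
        A₁⊆∁A₂ k∈A₁ = x∉p⇒x∈∁p λ k∈A₂ → ∉⊥ (≡.subst (_ ∈_) A₁∩A₂≡⊥ (x∈p∩q⁺ (k∈A₁ , k∈A₂)))
      ... | u , c , Σu≈0 , level with extremal-exists u c level A₁∈K A₂∈K°
      ...   | x , x∈ , ext = u , Σu≈0 , (x , Extremal⇒maximiser u c x∈ ext) ,
                             ≐-trans C≐ (≐-sym (normalCone≐cone level A₁∈K A₂∈K°))

      normal⊆ : ∀ {C} → normalFan P C → canonicalFan K C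
      normal⊆ (u , _ , _ , C≐) with level-exists K proper u
      ... | c , A₁ , A₂ , level , A₁∈K , A₂∈K° =
        A₁ , A₂ , A₁∈K , A₂∈K° ,
        Empty-unique (λ (k , k∈) →
          let (k∈A₁ , k∈A₂) = x∈p∩q⁻ A₁ A₂ k∈ in x∈∁p⇒x∉p (IsLevel.disjoint level k∈A₁) k∈A₂) ,
        ≐-trans C≐ (normalCone≐cone level A₁∈K A₂∈K°)

-- From a polytope to weights.

module PolytopalFan {r} (ℝ : RealField r) where
  open RealField ℝ hiding (zero)
  open Geometry ℝ
  open OrderedField ℝ
  open Sums ℝ
  open Cones ℝ
  open Polytopes ℝ
  open ≤-Reasoning strictPartialOrder

  δ-off : ∀ (j k : Fin n) → j ≢ k → δ k j ≈ 0# - ν n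
  δ-off j k j≢k = trans (δ≈ k j) (+-congʳ (reflexive (e-off j≢k)))

  δ-off≤ : ∀ (j k : Fin n) → 0# - ν n ≤ δ k j
  δ-off≤ {n} j k = ≤-respʳ-≈ (sym (δ≈ k j)) (+-monoˡ-≤ (- ν n) (0≤e j k))

  δ̄-dip : ∀ {j k : Fin n} → j ≢ k → δ̄ k k < δ̄ k j
  δ̄-dip {n} {j} {k} j≢k = -‿anti-mono-< (begin-strict
    δ k j       ≈⟨ δ-off j k j≢k ⟩
    0# - ν n    <⟨ +-monoˡ-< (- ν n) 0<1 ⟩
    1# - ν n    ≡⟨ ≡.cong (_- ν n) (e-diag k) ⟨
    e k k - ν n ≈⟨ δ≈ k k ⟨
    δ k k       ∎)

  δ-H₀ : .{{_ : NonZero n}} (k : Fin n) → H₀ (δ k)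
  δ-H₀ {n} k = trans (sum-cong-≋ δ≈centre) (centre-H₀ (e k))
    where
    δ≈centre : ∀ j → δ k j ≈ centre (e k) j
    δ≈centre j = trans (δ≈ k j)
      (+-cong (reflexive (e-sym j k)) (-‿cong (trans (sym (*-identityʳ (ν n))) (*-congˡ (sym (sum-e k))))))

  δ̄-H₀ : .{{_ : NonZero n}} (k : Fin n) → H₀ (δ̄ k)
  δ̄-H₀ k = trans (sum-neg (δ k)) (trans (-‿cong (δ-H₀ k)) -0#≈0#)

  δ∈cone : .{{_ : NonZero n}} → ∀ {A₁ A₂ : Subset n} {k} → k ∈ A₁ → cone A₁ A₂ (δ k)
  -- The level is `0# - ν n`, the common value of `δ k` off `k`.
  δ∈cone {A₁ = A₁} {A₂} {k} k∈A₁ = Cut⇒cone {A₁ = A₁} {A₂} (δ-H₀ k) λ j →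
    (λ _ → δ-off≤ j k) , (λ j∉A₁ → inj₂ (δ-off j k λ { ≡.refl → j∉A₁ k∈A₁ }))

  δ̄∈cone : .{{_ : NonZero n}} → ∀ {A₁ A₂ : Subset n} {k} → k ∈ A₂ → cone A₁ A₂ (δ̄ k)
  δ̄∈cone {A₁ = A₁} {A₂} {k} k∈A₂ = Cut⇒cone {A₁ = A₁} {A₂} (δ̄-H₀ k) λ j →
    (λ j∉A₂ → inj₂ (-‿cong (sym (δ-off j k λ { ≡.refl → j∉A₂ k∈A₂ })))) ,
    (λ _ → -‿anti-mono-≤ (δ-off≤ j k))

  -- `δ̄ k` has its strict minimum at `k`. Membership puts `δ̄ k` at or above the level at `k` and
  -- at or below it off `A`, so `k` is the only index off `A`; since `i` is one too, they coincide.
  δ̄∈pivotCone⁻ : ∀ (A : Subset n) i k → i ∉ A → k ∈ A ∪ ⁅ i ⁆ → cone A (∁ (A ∪ ⁅ i ⁆)) (δ̄ k) →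
                 k ≡ i × (∀ {j} → j ≢ i → j ∈ A)
  δ̄∈pivotCone⁻ A i k i∉A k∈A∪i δ̄∈ with cone⇒Cut {A₁ = A} {∁ (A ∪ ⁅ i ⁆)} δ̄∈
  ... | c , cut = ≡.sym i≡k , λ {j} j≢i → decidable-stable (j ∈? A) λ j∉A →
    j≢i (≡.trans (off-A j∉A) (≡.sym i≡k))
    where
    off-A : ∀ {j} → j ∉ A → j ≡ k
    off-A {j} j∉A = decidable-stable (j ≟ k) λ j≢k →
      ≤⇒≯ (≤-trans (proj₂ (cut j) j∉A) (proj₁ (cut k) (x∈p⇒x∉∁p k∈A∪i))) (δ̄-dip j≢k)
    i≡k : i ≡ k
    i≡k = off-A i∉A

  -- `sumOver-split` for `x - lo`. The bounds are arbitrary vectors, because the identity is applied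
  -- to `lo` and later to the lowered `lo′`.
  sum-at-pivot : ∀ {lo hi x : Vector Carrier n} {A i} → i ∉ A → H₀ x →
                 (∀ k → k ∈ A → x k ≈ hi k) → (∀ k → k ∉ A → k ≢ i → x k ≈ lo k) →
                 - sum lo ≈ sumOver A (λ k → hi k - lo k) + (x i - lo i)
  sum-at-pivot {lo = lo} {hi} {x} {A} {i} i∉A Σx≈0 x≈hi x≈lo = begin-equality
    - sum lo                                       ≈⟨ +-identityˡ _ ⟨
    0# - sum lo                                    ≈⟨ +-congʳ Σx≈0 ⟨
    sum x - sum lo                                 ≈⟨ sum-minus x lo ⟨
    sum (λ k → x k - lo k)                         ≈⟨ sumOver-split i∉A
                                                        (λ k k∈A → +-congʳ (x≈hi k k∈A))
                                                        (λ k k∉A k≢i → x≈y⇒x∙y⁻¹≈ε (x≈lo k k∉A k≢i)) ⟩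
    sumOver A (λ k → hi k - lo k) + (x i - lo i)   ∎

  coordinate-max : ∀ (P : Polytope n) → Satisfiable (hull P) → ∀ k → ∃[ h ]
                   ((∀ {x} → hull P x → x k ≤ h) × (∀ {x} → maximisers P (δ k) x → h ≤ x k))
  coordinate-max P nonempty k with maximiser-exists P nonempty (δ k)
  ... | z , z∈ , z-max = z k ,
    (λ x∈ → ≤-respˡ-≈ (coord x∈) (≤-respʳ-≈ (coord z∈) (z-max _ x∈))) ,
    (λ (x∈ , x-max) → ≤-respˡ-≈ (coord z∈) (≤-respʳ-≈ (coord x∈) (x-max z z∈)))
    where
    coord : ∀ {x} → hull P x → ⟨ δ k , x ⟩ ≈ x k
    coord x∈ = ⟨δ,⟩ k (hull⊆H₀ P x∈)

  coordinate-min : ∀ (P : Polytope n) → Satisfiable (hull P) → ∀ k → ∃[ l ]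
                   ((∀ {x} → hull P x → l ≤ x k) × (∀ {x} → maximisers P (δ̄ k) x → x k ≤ l))
  coordinate-min P nonempty k with maximiser-exists P nonempty (δ̄ k)
  ... | z , z∈ , z-max = z k ,
    (λ x∈ → -‿cancel-≤ (≤-respˡ-≈ (coord x∈) (≤-respʳ-≈ (coord z∈) (z-max _ x∈)))) ,
    (λ (x∈ , x-max) → -‿cancel-≤ (≤-respˡ-≈ (coord z∈) (≤-respʳ-≈ (coord x∈) (x-max z z∈))))
    where
    coord : ∀ {x} → hull P x → ⟨ δ̄ k , x ⟩ ≈ - x k
    coord x∈ = ⟨δ̄,⟩ k (hull⊆H₀ P x∈)

  module _ {n} .{{_ : NonZero n}} (K : SimplicialComplex n) (proper : Proper K) (noGhost : NoGhostVertices K)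
           (P : Polytope n) (canonical⊆normal : ∀ {C} → canonicalFan K C → normalFan P C) where
    open SimplicialComplex K using (face?; ⊆-face; ∅-face)

    ⊤∉K : ¬ face K ⊤
    ⊤∉K ⊤∈K = proper λ A → ⊆-face ⊆⊤ ⊤∈K

    -- For a pivot this cone has one generator for each index other than `i`; these are the maximal
    -- cones of the fan.
    pivotCone : Subset n → Fin n → Cone n
    pivotCone A i = cone A (∁ (A ∪ ⁅ i ⁆))

    pivotCone-canonical : ∀ {A i} → Pivotal K A i → canonicalFan K (pivotCone A i)
    pivotCone-canonical {A} {i} (A∈K , A∪i∉K) =
      A , ∁ (A ∪ ⁅ i ⁆) , A∈K ,
      A∪i∉K ∘ ⊆-face (λ k∈ → x∉p⇒x∈∁p (x∈p⇒x∉∁p k∈)) ,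
      Empty-unique (λ (k , k∈) → let (k∈A , k∈∁) = x∈p∩q⁻ A _ k∈ in x∈∁p⇒x∉p k∈∁ (p⊆p∪q ⁅ i ⁆ k∈A)) ,
      (λ x∈ → x∈) , (λ x∈ → x∈)

    MaximisesCone : Subset n → Fin n → Vector Carrier n → Set r
    MaximisesCone A i x = hull P x × (∀ {y} → pivotCone A i y → maximisers P y x)

    -- The pivot cone is the normal cone of some face of `P`, and `v` is a point of that face. The
    -- last component recovers the cone from its common maximisers, without reference to the
    -- functional `u` defining the face: every point of the face is such a maximiser.
    vertex-of : ∀ {A i} → Pivotal K A i → ∃[ v ]
                  (MaximisesCone A i v ×
                   (∀ y → H₀ y → (∀ x → MaximisesCone A i x → maximisers P y x) → pivotCone A i y))
    vertex-of pivotal with canonical⊆normal (pivotCone-canonical pivotal)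
    ... | u , _ , (v , v-max) , C⊆N , N⊆C =
      v , (proj₁ v-max , λ y∈ → proj₂ (C⊆N y∈) v v-max) ,
      λ y Σy≈0 max → N⊆C (Σy≈0 , λ x x-max → max x (proj₁ x-max , λ y∈ → proj₂ (C⊆N y∈) x x-max))

    hull-nonempty : Satisfiable (hull P)
    hull-nonempty with pivotal-between K ∅-face ⊤∉K ⊆⊤
    ... | A , i , _ , _ , pivotal with canonical⊆normal (pivotCone-canonical pivotal)
    ...   | _ , _ , (v , v∈ , _) , _ = v , v∈

    abstract
      hi lo : Vector Carrier n
      hi k = proj₁ (coordinate-max P hull-nonempty k)
      lo k = proj₁ (coordinate-min P hull-nonempty k)

      ≤hi : ∀ {x} k → hull P x → x k ≤ hi k
      ≤hi k = proj₁ (proj₂ (coordinate-max P hull-nonempty k))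

      hi≤ : ∀ {x} k → maximisers P (δ k) x → hi k ≤ x k
      hi≤ k = proj₂ (proj₂ (coordinate-max P hull-nonempty k))

      lo≤ : ∀ {x} k → hull P x → lo k ≤ x k
      lo≤ k = proj₁ (proj₂ (coordinate-min P hull-nonempty k))

      ≤lo : ∀ {x} k → maximisers P (δ̄ k) x → x k ≤ lo k
      ≤lo k = proj₂ (proj₂ (coordinate-min P hull-nonempty k))

    lo⇒δ̄-maximiser : ∀ {x} k → hull P x → x k ≈ lo k → maximisers P (δ̄ k) x
    lo⇒δ̄-maximiser {x} k x∈ xk≈lo = x∈ , λ z z∈ →
      ≤-respˡ-≈ (sym (⟨δ̄,⟩ k (hull⊆H₀ P z∈))) (≤-respʳ-≈ (sym (⟨δ̄,⟩ k (hull⊆H₀ P x∈)))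
        (-‿anti-mono-≤ (≤-respˡ-≈ (sym xk≈lo) (lo≤ k z∈))))

    module _ {A i} (pivotal : Pivotal K A i) where
      private
        i∉A = pivotal⇒∉ K pivotal

      maximises⇒hi : ∀ {x} → MaximisesCone A i x → ∀ k → k ∈ A → x k ≈ hi k
      maximises⇒hi (x∈ , max) k k∈A =
        ≤-antisym (≤hi k x∈) (hi≤ k (max (δ∈cone {A₁ = A} {∁ (A ∪ ⁅ i ⁆)} k∈A)))

      maximises⇒lo : ∀ {x} → MaximisesCone A i x → ∀ k → k ∉ A → k ≢ i → x k ≈ lo k
      maximises⇒lo (x∈ , max) k k∉A k≢i =
        ≤-antisym (≤lo k (max (δ̄∈cone {A₁ = A} {∁ (A ∪ ⁅ i ⁆)} (x∉p⇒x∈∁p (i∉p∪⁅j⁆ k∉A k≢i)))))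
                  (lo≤ k x∈)

      -- All coordinates except the one at `i` are pinned to `hi` or `lo`, and that one is fixed by
      -- the zero coordinate sum. So a maximal cone belongs to a single vertex.
      maximises-unique : ∀ {x z} → MaximisesCone A i x → MaximisesCone A i z → ∀ k → x k ≈ z k
      maximises-unique {x} {z} x-max z-max k with k ∈? A | k ≟ i
      ... | yes k∈A | _          = trans (maximises⇒hi x-max k k∈A) (sym (maximises⇒hi z-max k k∈A))
      ... | no  k∉A | no  k≢i    = trans (maximises⇒lo x-max k k∉A k≢i) (sym (maximises⇒lo z-max k k∉A k≢i))
      ... | no  _   | yes ≡.refl = +-cancelʳ (- lo k) _ _ (+-cancelˡ (sumOver A (λ k → hi k - lo k)) _ _
                                     (trans (sym (at-pivot x-max)) (at-pivot z-max)))
        where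
        at-pivot : ∀ {x} → MaximisesCone A k x → - sum lo ≈ sumOver A (λ k → hi k - lo k) + (x k - lo k)
        at-pivot max = sum-at-pivot i∉A (hull⊆H₀ P (proj₁ max)) (maximises⇒hi max) (maximises⇒lo max)

      abstract
        v : Vector Carrier n
        v = proj₁ (vertex-of pivotal)

        v-max : MaximisesCone A i v
        v-max = proj₁ (proj₂ (vertex-of pivotal))

      v∈hull : hull P v
      v∈hull = proj₁ v-max

      -- As `v` is the only common maximiser, minimality of its `k`-th coordinate makes `δ̄ k`
      -- maximal on all of them, hence a member of their normal cone.
      v≈lo⇒δ̄∈pivotCone : ∀ k → v k ≈ lo k → pivotCone A i (δ̄ k)
      v≈lo⇒δ̄∈pivotCone k vk≈lo = proj₂ (proj₂ (vertex-of pivotal)) (δ̄ k) (δ̄-H₀ k) λ x x-max →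
        lo⇒δ̄-maximiser k (proj₁ x-max) (trans (maximises-unique x-max v-max k) vk≈lo)

      -- Equality would put `δ̄ k` in the pivot cone, which for `k` in `A ∪ ⁅ i ⁆` happens only at
      -- `k ≡ i`, and `i` is not in `A`.
      lo<v : ∀ {k} → k ∈ A → lo k < v k
      lo<v {k} k∈A = ≰⇒> λ vk≤lo →
        let δ̄∈      = v≈lo⇒δ̄∈pivotCone k (≤-antisym vk≤lo (lo≤ k v∈hull))
            k≡i , _ = δ̄∈pivotCone⁻ A i k i∉A (p⊆p∪q ⁅ i ⁆ k∈A) δ̄∈
        in i∉A (≡.subst (_∈ A) k≡i k∈A)

      -- If the pivot coordinate is at its minimum, `δ̄∈pivotCone⁻` shows that `A` contains every
      -- index other than `i`.
      lo<v-pivot⊎face : lo i < v i ⊎ face K (∁ ⁅ i ⁆)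
      lo<v-pivot⊎face = [ inj₁ , inj₂ ∘ (λ lo≈vi → ⊆-face (∁i⊆A (sym lo≈vi)) (proj₁ pivotal)) ]′ (lo≤ i v∈hull)
        where
        ∁i⊆A : v i ≈ lo i → ∁ ⁅ i ⁆ ⊆ A
        ∁i⊆A vi≈lo j∈ = proj₂ (δ̄∈pivotCone⁻ A i i i∉A (x∈p∪⁅x⁆ A i) (v≈lo⇒δ̄∈pivotCone i vi≈lo))
                          (x∉⁅y⁆⇒x≢y (x∈∁p⇒x∉p j∈))

    -- When ∁ ⁅ k ⁆ is a face, δ̄ k spans no ray of the fan and lo k may be attained at a pivot (A , k).
    -- But then k ∈ A ∪ ⁅ i ⁆ for every pivot (A , i), so no equation v k = lo k is used, and lo k can be
    -- lowered to make the inequality lo i ≤ v i strict at all pivots.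
    lo′ : Vector Carrier n
    lo′ k = if does (face? (∁ ⁅ k ⁆)) then lo k - 1# else lo k

    lo′≤lo : ∀ k → lo′ k ≤ lo k
    lo′≤lo k with face? (∁ ⁅ k ⁆)
    ... | yes _ = inj₁ (x-1<x (lo k))
    ... | no  _ = ≤-refl

    w : Vector Carrier n
    w k = hi k - lo′ k

    q : Carrier
    q = - sum lo′

    lo′<lo : ∀ k → face K (∁ ⁅ k ⁆) → lo′ k < lo k
    lo′<lo k ∁k∈K with face? (∁ ⁅ k ⁆)
    ... | yes _    = x-1<x (lo k)
    ... | no  ∁k∉K = contradiction ∁k∈K ∁k∉K

    lo′≡lo : ∀ k → ¬ face K (∁ ⁅ k ⁆) → lo′ k ≡ lo k
    lo′≡lo k ∁k∉K with face? (∁ ⁅ k ⁆)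
    ... | yes ∁k∈K = contradiction ∁k∈K ∁k∉K
    ... | no  _    = ≡.refl

    module _ {A i} (pivotal : Pivotal K A i) where

      lo′<v-pivot : lo′ i < v pivotal i
      lo′<v-pivot =
        [ ≤-<-trans (lo′≤lo i) , (λ ∁i∈K → <-≤-trans (lo′<lo i ∁i∈K) (lo≤ i (v∈hull pivotal))) ]′
          (lo<v-pivot⊎face pivotal)

      v≈lo′ : ∀ k → k ∉ A → k ≢ i → v pivotal k ≈ lo′ k
      v≈lo′ k k∉A k≢i = trans (maximises⇒lo pivotal (v-max pivotal) k k∉A k≢i)
                              (reflexive (≡.sym (lo′≡lo k (proj₂ pivotal ∘ ⊆-face A∪i⊆∁k))))
        where
        A∪i⊆∁k : A ∪ ⁅ i ⁆ ⊆ ∁ ⁅ k ⁆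
        A∪i⊆∁k j∈ = x∉p⇒x∈∁p λ j∈k → i∉p∪⁅j⁆ k∉A k≢i (≡.subst (_∈ A ∪ ⁅ i ⁆) (x∈⁅y⁆⇒x≡y k j∈k) j∈)

      q≈ : q ≈ sumOver A w + (v pivotal i - lo′ i)
      q≈ = sum-at-pivot (pivotal⇒∉ K pivotal) (hull⊆H₀ P (v∈hull pivotal))
             (maximises⇒hi pivotal (v-max pivotal)) v≈lo′

      sumOver<q : sumOver A w < q
      sumOver<q = begin-strict
        sumOver A w                             ≈⟨ +-identityʳ _ ⟨
        sumOver A w + 0#                        <⟨ +-monoʳ-< _ (x<y⇒0<y-x lo′<v-pivot) ⟩
        sumOver A w + (v pivotal i - lo′ i)     ≈⟨ q≈ ⟨
        q                                       ∎

      q≤sumOver : q ≤ sumOver (A ∪ ⁅ i ⁆) w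
      q≤sumOver = begin
        q                                       ≈⟨ q≈ ⟩
        sumOver A w + (v pivotal i - lo′ i)     ≤⟨ +-monoʳ-≤ _ (+-monoˡ-≤ (- lo′ i) (≤hi i (v∈hull pivotal))) ⟩
        sumOver A w + w i                       ≈⟨ sumOver-∪⁅⁆ w (pivotal⇒∉ K pivotal) ⟨
        sumOver (A ∪ ⁅ i ⁆) w                   ∎

    0<w : ∀ k → 0# < w k
    0<w k =
      -- The vertex `k` is a face, so it extends to the face `A` of some pivot; there the `k`-th
      -- coordinate is above `lo k`.
      let (A , i , k⊆A , _ , pivotal) = pivotal-between K (noGhost k) ⊤∉K ⊆⊤
      in x<y⇒0<y-x (begin-strict
        lo′ k        ≤⟨ lo′≤lo k ⟩
        lo k         <⟨ lo<v pivotal (k⊆A (x∈⁅x⁆ k)) ⟩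
        v pivotal k  ≤⟨ ≤hi k (v∈hull pivotal) ⟩
        hi k         ∎)

    -- Weights are monotone, so the pivots decide: a face lies inside the face `B` of a pivot, and a
    -- nonface contains some `B ∪ ⁅ i ⁆`.
    face⇔ : ∀ A → face K A ⇔ sumOver A w < q
    face⇔ A = mk⇔ to from
      where
      0≤w : ∀ k → 0# ≤ w k
      0≤w k = inj₁ (0<w k)

      to : face K A → sumOver A w < q
      to A∈K =
        let (B , i , A⊆B , _ , pivotal) = pivotal-between K A∈K ⊤∉K ⊆⊤
        in ≤-<-trans (sumOver-mono-⊆ 0≤w A⊆B) (sumOver<q pivotal)

      from : sumOver A w < q → face K A
      from A<q = decidable-stable (face? A) λ A∉K →
        let (B , i , _ , B∪i⊆A , pivotal) = pivotal-between K ∅-face A∉K ⊥⊆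
        in ≤⇒≯ (≤-trans (q≤sumOver pivotal) (sumOver-mono-⊆ 0≤w B∪i⊆A)) A<q

    isThreshold : IsThreshold K
    isThreshold = w , q , 0<w , face⇔

-- Threshold complexes as weighted majority games.

module Games {r} (ℝ : RealField r) where
  open RealField ℝ hiding (zero)
  open Geometry ℝ
  open OrderedField ℝ

  threshold⇔game : ∀ (K : SimplicialComplex n) → IsThreshold K ⇔ IsPositiveWeightedMajorityGame (winning K)
  threshold⇔game K = mk⇔
    (λ (w , q , 0<w , face⇔) → w , q , 0<w , λ A → mk⇔
      (λ A∉K → ≮⇒≥ (A∉K ∘ Equivalence.from (face⇔ A)))
      (λ q≤A A∈K → ≤⇒≯ q≤A (Equivalence.to (face⇔ A) A∈K)))
    (λ (w , q , 0<w , winning⇔) → w , q , 0<w , λ A → mk⇔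
      (λ A∈K → ≰⇒> λ q≤A → Equivalence.from (winning⇔ A) q≤A A∈K)
      (λ A<q → decidable-stable (face? A) λ A∉K → ≤⇒≯ (Equivalence.to (winning⇔ A) A∉K) A<q))
    where open SimplicialComplex K using (face?)

theorem1p1 : {r : Level} (ℝ : RealField r) → let open Geometry ℝ in
    (n : ℕ) (K : SimplicialComplex n) → Proper K → NoGhostVertices K →
    (IsThreshold K ⇔ IsPositiveWeightedMajorityGame (winning K)) ×
    (IsThreshold K ⇔ IsPolytopal (canonicalFan K))
-- The empty set is the only subset of `[0]` and always a face, so no complex is proper.
theorem1p1 ℝ zero K proper noGhost =
  contradiction (λ { [] → SimplicialComplex.∅-face K }) proper
theorem1p1 ℝ n@(suc _) K proper noGhost = threshold⇔game K , mk⇔ polytopal threshold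
  where
  open RealField ℝ hiding (zero)
  open Geometry ℝ
  open OrderedField ℝ using (<-separates; <-≤-trans; ≮⇒≥)
  open Games ℝ
  open ThresholdFan ℝ using (P; canonicalFan≐normalFan)
  open PolytopalFan ℝ using (isThreshold)

  polytopal : IsThreshold K → IsPolytopal (canonicalFan K)
  polytopal (w , q , 0<w , face⇔) =
    -- A nonface may weigh exactly `q`. Lowering the quota while staying above all faces makes both
    -- inequalities strict.
    let q′ , q′<q , face<q′ =
          <-separates (SimplicialComplex.face? K) (λ A → sumOver A w) (λ A → Equivalence.to (face⇔ A))
        q′<nonface : ∀ A → ¬ face K A → q′ < sumOver A w
        q′<nonface A A∉K = <-≤-trans q′<q (≮⇒≥ (A∉K ∘ Equivalence.from (face⇔ A)))
    in P K proper w q′ 0<w face<q′ q′<nonface ,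
       canonicalFan≐normalFan K proper w q′ 0<w face<q′ q′<nonface

  threshold : IsPolytopal (canonicalFan K) → IsThreshold K
  threshold (P , canonical⊆normal , _) = isThreshold K proper noGhost P canonical⊆normal
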